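{- Let $m$ be a positive odd integer and let $d$ be an integer. Then $$f^{(m)}_{md+2}(x)\in\begin{cases}\mathscr{P}^{(m-2)} & \text{if } d \text{ is even},\\ \mathscr{A}^{(m-2)} & \text{if } d\text{ is odd.}\end{cases}$$ Equivalently, when $md+2\ge 0$, $\tilde\beta_{md+2}(m,x)$ lies in $\mathscr{P}^{(m-2)}$ if $d$ is even and in $\mathscr{A}^{(m-2)}$ if $d$ is odd. Consequently, $\tilde\beta_{md+2}(m)=0$ whenever $d$ is odd (and $md+2\ge 0$).
   Context: For a positive integer $m$ let $\Psi_m(x)=\sum_{j=0}^{m-1}x^j$. The polynomial $1-x$ is invertible modulo $\Psi_m(x)$ over $\mathbb{Q}$; for $k\in\mathbb{Z}$ let $f_k^{(m)}(x)\in\mathbb{Q}[x]$ be the unique polynomial of degree less than $\deg\Psi_m=m-1$ (the zero polynomial if $m=1$) congruent to $(1-x)^{ -k}$ modulo $\Psi_m(x)$. For $k\ge 0$ let $\tilde\beta_k(m,x)=(-1)^k k!\,f_k^{(m)}(x)$. The degenerate Bernoulli numbers $\beta_k(\lambda)$ ($\lambda\ne0$) are defined by $\frac{t}{(1+\lambda t)^{1/\lambda}-1}=\sum_{k\ge 0}\beta_k(\lambda)\frac{t^k}{k!}$, and $\tilde\beta_k(m)=m^k\beta_k(1/m)$; equivalently $\frac{m}{\Psi_m(x)}=\sum_{k\ge 0}\frac{(-1)^k}{k!}\tilde\beta_k(m)(1-x)^k$. For an integer $n$, $\mathscr{P}^{(n)}$ (palindromic polynomials of darga $n$) is the set of real polynomials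 $p(x)$ with $x^np(1/x)=p(x)$, and $\mathscr{A}^{(n)}$ (anti-palindromic polynomials of darga $n$) is the set of real polynomials $p(x)$ with $x^np(1/x)=-p(x)$; i.e. writing $\alpha_j$ for the coefficient of $x^j$ in $p$ (zero if $x^j$ does not occur), $\alpha_j=\alpha_{n-j}$, respectively $\alpha_j=-\alpha_{n-j}$, for all $j\in\mathbb{Z}$. The zero polynomial belongs to both. -}

module Defs where

import Algebra.Definitions.RawSemiring
import Algebra.Properties.Group
open import Data.Integer.Base as ℤ using (ℤ; +_; -[1+_])
open import Data.List.Base using (List; []; _∷_; map; replicate)
open import Data.Nat.Base as ℕ using (ℕ; zero; suc; _∸_; z≤n; s≤s; _!)
import Data.Nat.Properties as ℕ
open import Data.Product using (∃; ∃!; _×_; _,_; proj₁; proj₂)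
open import Data.Rational.Base as ℚ
  using (ℚ; 0ℚ; 1ℚ; _+_; _*_; _-_; -_; 1/_; _/_; toℚᵘ)
import Data.Rational.Properties as ℚ
open import Data.Rational.Solver using (module +-*-Solver)
import Data.Rational.Unnormalised.Base as ℚᵘ
import Data.Rational.Unnormalised.Properties as ℚᵘ
import Data.Integer.Properties as ℤ
open import Function.Base using (_∘_)
open import Level using (0ℓ)
open import Relation.Binary.PropositionalEquality
open import Relation.Nullary.Decidable using (yes; no)
open import Relation.Unary using (Pred)

open Algebra.Definitions.RawSemiring ℚ.+-*-rawSemiring public using (_^_)
open Algebra.Properties.Group ℚ.+-0-group using () renaming (∙-cancelˡ to +-cancelˡ)

fromℕ : ℕ → ℚ
fromℕ n = + n / 1

fromℕ-suc : ∀ m → fromℕ (suc m) ≡ 1ℚ + fromℕ m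
fromℕ-suc m = ℚ.toℚᵘ-injective (begin-equality
  toℚᵘ (fromℕ (suc m))               ≃⟨ ℚ.toℚᵘ-fromℚᵘ (ℚᵘ.mkℚᵘ (+ suc m) 0) ⟩
  ℚᵘ.mkℚᵘ (+ suc m) 0                ≃⟨ ℚᵘ.*≡* (cong (λ z → (+ 1 ℤ.+ z) ℤ.* + 1) (sym (ℤ.*-identityʳ (+ m)))) ⟩
  ℚᵘ.1ℚᵘ ℚᵘ.+ ℚᵘ.mkℚᵘ (+ m) 0        ≃⟨ ℚᵘ.+-congʳ ℚᵘ.1ℚᵘ (ℚ.toℚᵘ-fromℚᵘ (ℚᵘ.mkℚᵘ (+ m) 0)) ⟨
  ℚᵘ.1ℚᵘ ℚᵘ.+ toℚᵘ (fromℕ m)         ≃⟨ ℚ.toℚᵘ-homo-+ 1ℚ (fromℕ m) ⟨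
  toℚᵘ (1ℚ + fromℕ m)                ∎)
  where
  open ℚᵘ.≤-Reasoning

1/n*n≡1 : ∀ n .{{_ : ℕ.NonZero n}} → (+ 1 / n) * fromℕ n ≡ 1ℚ
1/n*n≡1 (suc n) = ℚ.toℚᵘ-injective (begin-equality
  toℚᵘ ((+ 1 / suc n) * fromℕ (suc n))
    ≃⟨ ℚ.toℚᵘ-homo-* (+ 1 / suc n) (fromℕ (suc n)) ⟩
  toℚᵘ (+ 1 / suc n) ℚᵘ.* toℚᵘ (fromℕ (suc n))
    ≃⟨ ℚᵘ.*-cong (ℚ.toℚᵘ-fromℚᵘ (ℚᵘ.mkℚᵘ (+ 1) n)) (ℚ.toℚᵘ-fromℚᵘ (ℚᵘ.mkℚᵘ (+ suc n) 0)) ⟩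
  ℚᵘ.mkℚᵘ (+ 1) n ℚᵘ.* ℚᵘ.mkℚᵘ (+ suc n) 0
    ≃⟨ ℚᵘ.*≡* (trans (ℤ.*-comm (+ 1 ℤ.* + suc n) (+ 1)) (cong (+ 1 ℤ.*_)
         (trans (ℤ.*-identityˡ (+ suc n)) (cong (λ k → + suc k) (sym (ℕ.*-identityʳ n)))))) ⟩
  ℚᵘ.1ℚᵘ ∎)
  where
  open ℚᵘ.≤-Reasoning

open ≡-Reasoning
open +-*-Solver using (solve; con; _:=_; _:+_; _:*_; _:-_; :-_)

-- ℚ[x]: the list a₀ ∷ a₁ ∷ … stands for a₀ + a₁x + …  Trailing zeros are
-- allowed, so equality of polynomials is _≈_ and not _≡_.

Poly : Set
Poly = List ℚ

coeff : Poly → ℕ → ℚ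
coeff []      _       = 0ℚ
coeff (a ∷ p) zero    = a
coeff (a ∷ p) (suc j) = coeff p j

infix 4 _≈_ _≡_[mod_] degree_<_
infixl 6 _⊕_
infixl 7 _⊗_ _·_
infixr 8 _^ₚ_

_≈_ : Poly → Poly → Set
p ≈ q = coeff p ≗ coeff q

_⊕_ : Poly → Poly → Poly
[]      ⊕ q       = q
(a ∷ p) ⊕ []      = a ∷ p
(a ∷ p) ⊕ (b ∷ q) = (a + b) ∷ (p ⊕ q)

_·_ : ℚ → Poly → Poly
c · p = map (c *_) p

_⊗_ : Poly → Poly → Poly
[]      ⊗ q = []
(a ∷ p) ⊗ q = a · q ⊕ (0ℚ ∷ p ⊗ q)

1ₚ : Poly
1ₚ = 1ℚ ∷ []

_^ₚ_ : Poly → ℕ → Poly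
p ^ₚ zero  = 1ₚ
p ^ₚ suc n = p ⊗ p ^ₚ n

-- The zero polynomial satisfies degree p < n for every n, including n = 0.
degree_<_ : Poly → ℕ → Set
degree p < n = ∀ j → n ℕ.≤ j → coeff p j ≡ 0ℚ

_≡_[mod_] : Poly → Poly → Poly → Set
p ≡ q [mod r ] = ∃ λ s → p ≈ q ⊕ s ⊗ r

Ψ : ℕ → Poly
Ψ m = replicate m 1ℚ

1-x : Poly
1-x = 1ℚ ∷ - 1ℚ ∷ []

-- xⁿp(1/x) = p(x), resp. = -p(x), stated on coefficients indexed by ℤ.
-- Real coefficients are not needed: every polynomial considered here is
-- rational, and membership is a condition on its coefficients only.

coeffℤ : Poly → ℤ → ℚ
coeffℤ p (+ j)    = coeff p j
coeffℤ p -[1+ _ ] = 0ℚ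

𝒫 : ℤ → Pred Poly 0ℓ
𝒫 n p = ∀ (j : ℤ) → coeffℤ p j ≡ coeffℤ p (n ℤ.- j)

𝒜 : ℤ → Pred Poly 0ℓ
𝒜 n p = ∀ (j : ℤ) → coeffℤ p j ≡ - coeffℤ p (n ℤ.- j)

coeff-⊕ : ∀ p q j → coeff (p ⊕ q) j ≡ coeff p j + coeff q j
coeff-⊕ []      q       j       = sym (ℚ.+-identityˡ _)
coeff-⊕ (a ∷ p) []      j       = sym (ℚ.+-identityʳ _)
coeff-⊕ (a ∷ p) (b ∷ q) zero    = refl
coeff-⊕ (a ∷ p) (b ∷ q) (suc j) = coeff-⊕ p q j

coeff-· : ∀ c p j → coeff (c · p) j ≡ c * coeff p j
coeff-· c []      j       = sym (ℚ.*-zeroʳ c)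
coeff-· c (a ∷ p) zero    = refl
coeff-· c (a ∷ p) (suc j) = coeff-· c p j

coeff-∷⊗ : ∀ a p q j → coeff ((a ∷ p) ⊗ q) j ≡ a * coeff q j + coeff (0ℚ ∷ p ⊗ q) j
coeff-∷⊗ a p q j = trans (coeff-⊕ (a · q) _ j) (cong (_+ _) (coeff-· a q j))

shift : Poly → ℕ → ℚ
shift p = coeff (0ℚ ∷ p)

coeff-0∷[] : ∀ j → coeff (0ℚ ∷ []) j ≡ 0ℚ
coeff-0∷[] zero    = refl
coeff-0∷[] (suc _) = refl

coeff-[1-x]⊗ : ∀ q j → coeff (1-x ⊗ q) j ≡ coeff q j - shift q j
coeff-[1-x]⊗ q zero = begin
  coeff (1-x ⊗ q) 0                ≡⟨ coeff-∷⊗ 1ℚ (- 1ℚ ∷ []) q 0 ⟩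
  1ℚ * coeff q 0 + 0ℚ              ≡⟨ solve 1 (λ a → con 1ℚ :* a :+ con 0ℚ := a :- con 0ℚ) refl (coeff q 0) ⟩
  coeff q 0 - 0ℚ                   ∎
coeff-[1-x]⊗ q (suc j) = begin
  coeff (1-x ⊗ q) (suc j)
    ≡⟨ coeff-∷⊗ 1ℚ (- 1ℚ ∷ []) q (suc j) ⟩
  1ℚ * coeff q (suc j) + coeff ((- 1ℚ ∷ []) ⊗ q) j
    ≡⟨ cong (λ z → 1ℚ * coeff q (suc j) + z) (coeff-∷⊗ (- 1ℚ) [] q j) ⟩
  1ℚ * coeff q (suc j) + ((- 1ℚ) * coeff q j + coeff (0ℚ ∷ []) j)
    ≡⟨ cong (λ z → 1ℚ * coeff q (suc j) + ((- 1ℚ) * coeff q j + z)) (coeff-0∷[] j) ⟩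
  1ℚ * coeff q (suc j) + ((- 1ℚ) * coeff q j + 0ℚ)
    ≡⟨ solve 2 (λ a b → con 1ℚ :* a :+ (con (- 1ℚ) :* b :+ con 0ℚ) := a :- b) refl (coeff q (suc j)) (coeff q j) ⟩
  coeff q (suc j) - coeff q j ∎

∑Ψ : ℕ → Poly
∑Ψ zero    = []
∑Ψ (suc m) = ∑Ψ m ⊕ Ψ m

-- (1 - x) · ∑_{i<m} Ψ_i = m - Ψ_m, whence the inverse of 1 - x.
inverse[1-x] : (m : ℕ) .{{_ : ℕ.NonZero m}} → Poly
inverse[1-x] m = (+ 1 / m) · ∑Ψ m

[1-x]⊗∑Ψ : ∀ m → 1-x ⊗ ∑Ψ m ⊕ Ψ m ≈ fromℕ m ∷ []
[1-x]⊗∑Ψ m j = trans (coeff-⊕ (1-x ⊗ ∑Ψ m) (Ψ m) j)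
                 (trans (cong (_+ coeff (Ψ m) j) (coeff-[1-x]⊗ (∑Ψ m) j)) (main m j))
  where
  main : ∀ m j → (coeff (∑Ψ m) j - shift (∑Ψ m) j) + coeff (Ψ m) j ≡ coeff (fromℕ m ∷ []) j
  main zero    zero    = refl
  main zero    (suc j) = refl
  main (suc m) zero    = begin
    (coeff (∑Ψ m ⊕ Ψ m) 0 - 0ℚ) + 1ℚ
      ≡⟨ cong (λ z → (z - 0ℚ) + 1ℚ) (coeff-⊕ (∑Ψ m) (Ψ m) 0) ⟩
    ((coeff (∑Ψ m) 0 + coeff (Ψ m) 0) - 0ℚ) + 1ℚ
      ≡⟨ solve 2 (λ a b → ((a :+ b) :- con 0ℚ) :+ con 1ℚ := con 1ℚ :+ ((a :- con 0ℚ) :+ b)) refl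
           (coeff (∑Ψ m) 0) (coeff (Ψ m) 0) ⟩
    1ℚ + ((coeff (∑Ψ m) 0 - 0ℚ) + coeff (Ψ m) 0)
      ≡⟨ cong (λ z → 1ℚ + z) (main m 0) ⟩
    1ℚ + fromℕ m
      ≡⟨ fromℕ-suc m ⟨
    fromℕ (suc m) ∎
  main (suc m) (suc j) = begin
    (coeff (∑Ψ m ⊕ Ψ m) (suc j) - coeff (∑Ψ m ⊕ Ψ m) j) + coeff (Ψ m) j
      ≡⟨ cong₂ (λ y z → (y - z) + coeff (Ψ m) j) (coeff-⊕ (∑Ψ m) (Ψ m) (suc j)) (coeff-⊕ (∑Ψ m) (Ψ m) j) ⟩
    ((coeff (∑Ψ m) (suc j) + coeff (Ψ m) (suc j)) - (coeff (∑Ψ m) j + coeff (Ψ m) j)) + coeff (Ψ m) j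
      ≡⟨ solve 4 (λ a b c d → ((a :+ b) :- (c :+ d)) :+ d := (a :- c) :+ b) refl
           (coeff (∑Ψ m) (suc j)) (coeff (Ψ m) (suc j)) (coeff (∑Ψ m) j) (coeff (Ψ m) j) ⟩
    (coeff (∑Ψ m) (suc j) - coeff (∑Ψ m) j) + coeff (Ψ m) (suc j)
      ≡⟨ main m (suc j) ⟩
    0ℚ ∎

inverse[1-x]-correct : ∀ m .{{_ : ℕ.NonZero m}} → 1-x ⊗ inverse[1-x] m ≡ 1ₚ [mod Ψ m ]
inverse[1-x]-correct m = (- c) ∷ [] , eq
  where
  c = + 1 / m
  h = ∑Ψ m

  shift-· : ∀ j → shift (c · h) j ≡ c * shift h j
  shift-· zero    = sym (ℚ.*-zeroʳ c)
  shift-· (suc j) = coeff-· c h j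

  constant : ∀ j → c * coeff (fromℕ m ∷ []) j ≡ coeff 1ₚ j
  constant zero    = 1/n*n≡1 m
  constant (suc j) = ℚ.*-zeroʳ c

  relation : ∀ j → (coeff h j - shift h j) + coeff (Ψ m) j ≡ coeff (fromℕ m ∷ []) j
  relation j = trans (cong (_+ coeff (Ψ m) j) (sym (coeff-[1-x]⊗ h j)))
                 (trans (sym (coeff-⊕ (1-x ⊗ h) (Ψ m) j)) ([1-x]⊗∑Ψ m j))

  eq : 1-x ⊗ (c · h) ≈ 1ₚ ⊕ ((- c) ∷ []) ⊗ Ψ m
  eq j = begin
    coeff (1-x ⊗ (c · h)) j
      ≡⟨ coeff-[1-x]⊗ (c · h) j ⟩
    coeff (c · h) j - shift (c · h) j
      ≡⟨ cong₂ _-_ (coeff-· c h j) (shift-· j) ⟩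
    c * coeff h j - c * shift h j
      ≡⟨ solve 4 (λ c a b d → c :* a :- c :* b := c :* ((a :- b) :+ d) :+ ((:- c) :* d :+ con 0ℚ)) refl
           c (coeff h j) (shift h j) (coeff (Ψ m) j) ⟩
    c * ((coeff h j - shift h j) + coeff (Ψ m) j) + ((- c) * coeff (Ψ m) j + 0ℚ)
      ≡⟨ cong₂ (λ y z → c * y + ((- c) * coeff (Ψ m) j + z)) (relation j) (sym (coeff-0∷[] j)) ⟩
    c * coeff (fromℕ m ∷ []) j + ((- c) * coeff (Ψ m) j + coeff (0ℚ ∷ []) j)
      ≡⟨ cong₂ _+_ (constant j) (sym (coeff-∷⊗ (- c) [] (Ψ m) j)) ⟩
    coeff 1ₚ j + coeff (((- c) ∷ []) ⊗ Ψ m) j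
      ≡⟨ coeff-⊕ 1ₚ (((- c) ∷ []) ⊗ Ψ m) j ⟨
    coeff (1ₚ ⊕ ((- c) ∷ []) ⊗ Ψ m) j ∎

-- A representative of (1 - x)ᵏ modulo Ψ m, k ∈ ℤ.
[1-x]^ : (m : ℕ) .{{_ : ℕ.NonZero m}} → ℤ → Poly
[1-x]^ m (+ n)    = 1-x ^ₚ n
[1-x]^ m -[1+ n ] = inverse[1-x] m ^ₚ suc n

coeff-Ψ< : ∀ {m j} → j ℕ.< m → coeff (Ψ m) j ≡ 1ℚ
coeff-Ψ< {suc m} {zero}  _         = refl
coeff-Ψ< {suc m} {suc j} (s≤s j<m) = coeff-Ψ< j<m

coeff-Ψ≥ : ∀ {m j} → m ℕ.≤ j → coeff (Ψ m) j ≡ 0ℚ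
coeff-Ψ≥ z≤n         = refl
coeff-Ψ≥ (s≤s m≤j) = coeff-Ψ≥ m≤j

remainder : ∀ n p → ∃ λ r → degree r < n × r ≡ p [mod Ψ (suc n) ]
remainder n [] = [] , (λ _ _ → refl) , [] , λ _ → refl
remainder n (a ∷ p) with remainder n p
... | r , deg , s , r≈ = r′ , deg′ , s′ , eq
  where
  top = coeff (a ∷ r) n
  r′  = (a ∷ r) ⊕ (- top) · Ψ (suc n)
  s′  = (- top) ∷ s

  coeff-r′ : ∀ j → coeff r′ j ≡ coeff (a ∷ r) j + (- top) * coeff (Ψ (suc n)) j
  coeff-r′ j = trans (coeff-⊕ (a ∷ r) ((- top) · Ψ (suc n)) j) (cong (λ z → coeff (a ∷ r) j + z) (coeff-· (- top) (Ψ (suc n)) j))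

  deg′ : degree r′ < n
  deg′ j n≤j with n ℕ.≟ j
  ... | yes refl = begin
    coeff r′ n                                  ≡⟨ coeff-r′ n ⟩
    top + (- top) * coeff (Ψ (suc n)) n         ≡⟨ cong (λ z → top + (- top) * z) (coeff-Ψ< (ℕ.n<1+n n)) ⟩
    top + (- top) * 1ℚ                          ≡⟨ solve 1 (λ t → t :+ (:- t) :* con 1ℚ := con 0ℚ) refl top ⟩
    0ℚ                                          ∎
  deg′ zero    n≤j | no n≢j with () ← n≢j (ℕ.n≤0⇒n≡0 n≤j)
  deg′ (suc j) n≤j | no n≢j with ℕ.≤∧≢⇒< n≤j n≢j
  ... | s≤s n≤j′ = begin
    coeff r′ (suc j)                              ≡⟨ coeff-r′ (suc j) ⟩
    coeff r j + (- top) * coeff (Ψ (suc n)) (suc j)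
      ≡⟨ cong₂ (λ y z → y + (- top) * z) (deg j n≤j′) (coeff-Ψ≥ (s≤s n≤j′)) ⟩
    0ℚ + (- top) * 0ℚ                             ≡⟨ solve 1 (λ t → con 0ℚ :+ t :* con 0ℚ := con 0ℚ) refl (- top) ⟩
    0ℚ                                            ∎

  step : ∀ j → coeff (a ∷ r) j ≡ coeff (a ∷ p) j + coeff (0ℚ ∷ s ⊗ Ψ (suc n)) j
  step zero    = sym (ℚ.+-identityʳ a)
  step (suc j) = trans (r≈ j) (coeff-⊕ p _ j)

  eq : r′ ≈ (a ∷ p) ⊕ s′ ⊗ Ψ (suc n)
  eq j = begin
    coeff r′ j
      ≡⟨ coeff-r′ j ⟩
    coeff (a ∷ r) j + (- top) * coeff (Ψ (suc n)) j
      ≡⟨ cong (_+ ((- top) * coeff (Ψ (suc n)) j)) (step j) ⟩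
    (coeff (a ∷ p) j + coeff (0ℚ ∷ s ⊗ Ψ (suc n)) j) + (- top) * coeff (Ψ (suc n)) j
      ≡⟨ solve 3 (λ x y z → (x :+ y) :+ z := x :+ (z :+ y)) refl
           (coeff (a ∷ p) j) (coeff (0ℚ ∷ s ⊗ Ψ (suc n)) j) ((- top) * coeff (Ψ (suc n)) j) ⟩
    coeff (a ∷ p) j + ((- top) * coeff (Ψ (suc n)) j + coeff (0ℚ ∷ s ⊗ Ψ (suc n)) j)
      ≡⟨ cong (λ z → coeff (a ∷ p) j + z) (coeff-∷⊗ (- top) s (Ψ (suc n)) j) ⟨
    coeff (a ∷ p) j + coeff (s′ ⊗ Ψ (suc n)) j
      ≡⟨ coeff-⊕ (a ∷ p) (s′ ⊗ Ψ (suc n)) j ⟨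
    coeff ((a ∷ p) ⊕ s′ ⊗ Ψ (suc n)) j ∎

⊕-⊗ : ∀ c s t q j → coeff ((s ⊕ c · t) ⊗ q) j ≡ coeff (s ⊗ q) j + c * coeff (t ⊗ q) j
⊕-⊗ c [] [] q j = solve 1 (λ c → con 0ℚ := con 0ℚ :+ c :* con 0ℚ) refl c
⊕-⊗ c [] (b ∷ t) q j = begin
  coeff ((c * b ∷ c · t) ⊗ q) j
    ≡⟨ coeff-∷⊗ (c * b) (c · t) q j ⟩
  (c * b) * coeff q j + shift (c · t ⊗ q) j
    ≡⟨ cong (λ z → (c * b) * coeff q j + z) (tail j) ⟩
  (c * b) * coeff q j + c * shift (t ⊗ q) j
    ≡⟨ solve 4 (λ c b x y → (c :* b) :* x :+ c :* y := con 0ℚ :+ c :* (b :* x :+ y)) refl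
         c b (coeff q j) (shift (t ⊗ q) j) ⟩
  0ℚ + c * (b * coeff q j + shift (t ⊗ q) j)
    ≡⟨ cong (λ z → 0ℚ + c * z) (coeff-∷⊗ b t q j) ⟨
  0ℚ + c * coeff ((b ∷ t) ⊗ q) j ∎
  where
  tail : ∀ j → shift (c · t ⊗ q) j ≡ c * shift (t ⊗ q) j
  tail zero    = sym (ℚ.*-zeroʳ c)
  tail (suc j) = trans (⊕-⊗ c [] t q j) (ℚ.+-identityˡ _)
⊕-⊗ c (a ∷ s) [] q j = solve 2 (λ x c → x := x :+ c :* con 0ℚ) refl (coeff ((a ∷ s) ⊗ q) j) c
⊕-⊗ c (a ∷ s) (b ∷ t) q j = begin
  coeff ((a + c * b ∷ s ⊕ c · t) ⊗ q) j
    ≡⟨ coeff-∷⊗ (a + c * b) (s ⊕ c · t) q j ⟩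
  (a + c * b) * coeff q j + shift ((s ⊕ c · t) ⊗ q) j
    ≡⟨ cong (λ z → (a + c * b) * coeff q j + z) (tail j) ⟩
  (a + c * b) * coeff q j + (shift (s ⊗ q) j + c * shift (t ⊗ q) j)
    ≡⟨ solve 6 (λ a b c x y z → (a :+ c :* b) :* x :+ (y :+ c :* z) := (a :* x :+ y) :+ c :* (b :* x :+ z)) refl
         a b c (coeff q j) (shift (s ⊗ q) j) (shift (t ⊗ q) j) ⟩
  (a * coeff q j + shift (s ⊗ q) j) + c * (b * coeff q j + shift (t ⊗ q) j)
    ≡⟨ cong₂ (λ y z → y + c * z) (coeff-∷⊗ a s q j) (coeff-∷⊗ b t q j) ⟨
  coeff ((a ∷ s) ⊗ q) j + c * coeff ((b ∷ t) ⊗ q) j ∎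
  where
  tail : ∀ j → shift ((s ⊕ c · t) ⊗ q) j ≡ shift (s ⊗ q) j + c * shift (t ⊗ q) j
  tail zero    = solve 1 (λ c → con 0ℚ := con 0ℚ :+ c :* con 0ℚ) refl c
  tail (suc j) = ⊕-⊗ c s t q j

multiple-zero : ∀ n t → degree t ⊗ Ψ (suc n) < n → ∀ j → coeff (t ⊗ Ψ (suc n)) j ≡ 0ℚ
multiple-zero n []      deg j = refl
multiple-zero n (c ∷ t) deg j = begin
  coeff ((c ∷ t) ⊗ Ψ (suc n)) j                         ≡⟨ coeff-∷⊗ c t (Ψ (suc n)) j ⟩
  c * coeff (Ψ (suc n)) j + shift (t ⊗ Ψ (suc n)) j     ≡⟨ cong₂ (λ y z → y * coeff (Ψ (suc n)) j + z) c≡0 (shift≡0 j) ⟩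
  0ℚ * coeff (Ψ (suc n)) j + 0ℚ                         ≡⟨ solve 1 (λ x → con 0ℚ :* x :+ con 0ℚ := con 0ℚ) refl (coeff (Ψ (suc n)) j) ⟩
  0ℚ                                                    ∎
  where
  deg-t : degree t ⊗ Ψ (suc n) < n
  deg-t i n≤i = begin
    coeff (t ⊗ Ψ (suc n)) i
      ≡⟨ solve 2 (λ x c → x := c :* con 0ℚ :+ x) refl (coeff (t ⊗ Ψ (suc n)) i) c ⟩
    c * 0ℚ + coeff (t ⊗ Ψ (suc n)) i
      ≡⟨ cong (λ z → c * z + coeff (t ⊗ Ψ (suc n)) i) (coeff-Ψ≥ (s≤s n≤i)) ⟨
    c * coeff (Ψ (suc n)) (suc i) + coeff (t ⊗ Ψ (suc n)) i
      ≡⟨ coeff-∷⊗ c t (Ψ (suc n)) (suc i) ⟨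
    coeff ((c ∷ t) ⊗ Ψ (suc n)) (suc i)
      ≡⟨ deg (suc i) (ℕ.m≤n⇒m≤1+n n≤i) ⟩
    0ℚ ∎

  shift≡0 : ∀ i → shift (t ⊗ Ψ (suc n)) i ≡ 0ℚ
  shift≡0 zero    = refl
  shift≡0 (suc i) = multiple-zero n t deg-t i

  c≡0 : c ≡ 0ℚ
  c≡0 = begin
    c
      ≡⟨ solve 1 (λ c → c := c :* con 1ℚ :+ con 0ℚ) refl c ⟩
    c * 1ℚ + 0ℚ
      ≡⟨ cong₂ (λ y z → c * y + z) (coeff-Ψ< (ℕ.n<1+n n)) (shift≡0 n) ⟨
    c * coeff (Ψ (suc n)) n + shift (t ⊗ Ψ (suc n)) n
      ≡⟨ coeff-∷⊗ c t (Ψ (suc n)) n ⟨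
    coeff ((c ∷ t) ⊗ Ψ (suc n)) n
      ≡⟨ deg n ℕ.≤-refl ⟩
    0ℚ ∎

remainder-unique : ∀ n {p r r′} →
  degree r < n → r ≡ p [mod Ψ (suc n) ] →
  degree r′ < n → r′ ≡ p [mod Ψ (suc n) ] → r ≈ r′
remainder-unique n {p} {r} {r′} deg (s , r≈) deg′ (s′ , r′≈) j = begin
  coeff r j                                       ≡⟨ trans (r≈ j) (coeff-⊕ p _ j) ⟩
  coeff p j + S j                                 ≡⟨ solve 3 (λ x y z → x :+ y := (x :+ z) :+ (y :+ con (- 1ℚ) :* z)) refl (coeff p j) (S j) (S′ j) ⟩
  (coeff p j + S′ j) + (S j + (- 1ℚ) * S′ j)      ≡⟨ cong₂ _+_ (sym (trans (r′≈ j) (coeff-⊕ p _ j))) (trans (sym (⊕-⊗ (- 1ℚ) s s′ Ψₙ j)) (multiple-zero n t deg-t j)) ⟩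
  coeff r′ j + 0ℚ                                 ≡⟨ ℚ.+-identityʳ _ ⟩
  coeff r′ j                                      ∎
  where
  Ψₙ = Ψ (suc n)
  S S′ : ℕ → ℚ
  S  = coeff (s ⊗ Ψₙ)
  S′ = coeff (s′ ⊗ Ψₙ)
  t  = s ⊕ (- 1ℚ) · s′
  deg-t : degree t ⊗ Ψₙ < n
  deg-t i n≤i = begin
    coeff (t ⊗ Ψₙ) i               ≡⟨ ⊕-⊗ (- 1ℚ) s s′ Ψₙ i ⟩
    S i + (- 1ℚ) * S′ i            ≡⟨ solve 3 (λ x y z → y :+ con (- 1ℚ) :* z := (x :+ y) :- (x :+ z)) refl (coeff p i) (S i) (S′ i) ⟩
    (coeff p i + S i) - (coeff p i + S′ i)
      ≡⟨ cong₂ _-_ (trans (sym (coeff-⊕ p _ i)) (sym (r≈ i))) (trans (sym (coeff-⊕ p _ i)) (sym (r′≈ i))) ⟩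
    coeff r i - coeff r′ i         ≡⟨ cong₂ _-_ (deg i n≤i) (deg′ i n≤i) ⟩
    0ℚ                             ∎

∃!f : ∀ m .{{_ : ℕ.NonZero m}} (k : ℤ) →
      ∃! _≈_ λ p → degree p < m ∸ 1 × p ≡ [1-x]^ m (ℤ.- k) [mod Ψ m ]
∃!f (suc n) k with remainder n ([1-x]^ (suc n) (ℤ.- k))
... | r , deg , r≡ = r , (deg , r≡) , λ {r′} (deg′ , r′≡) →
  remainder-unique n {[1-x]^ (suc n) (ℤ.- k)} {r} {r′} deg r≡ deg′ r′≡

f : (m : ℕ) .{{_ : ℕ.NonZero m}} → ℤ → Poly
f m k = proj₁ (∃!f m k)

-- β̃ₚ k m is the polynomial β̃ₖ(m, x); the number β̃ₖ(m) is β̃ below.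
β̃ₚ : (k m : ℕ) .{{_ : ℕ.NonZero m}} → Poly
β̃ₚ k m = ((- 1ℚ) ^ k * fromℕ (k !)) · f m (+ k)

-- A formal power series in t, given by its coefficients.
Series : Set
Series = ℕ → ℚ

infixl 7 _⊛_

-- Cauchy product, by recursion on the index:
-- ∑_{i+j=n+1} aᵢbⱼ = a₀bₙ₊₁ + ∑_{i+j=n} aᵢ₊₁bⱼ.
_⊛_ : Series → Series → Series
(a ⊛ b) zero    = a 0 * b 0
(a ⊛ b) (suc n) = a 0 * b (suc n) + ((a ∘ suc) ⊛ b) n

1ₛ : Series
1ₛ zero    = 1ℚ
1ₛ (suc _) = 0ℚ

tₛ : Series
tₛ zero    = 0ℚ
tₛ (suc n) = 1ₛ n

-- a (a - 1) ⋯ (a - n + 1) / n!, the coefficient of xⁿ in (1 + x)ᵃ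
binomial : ℚ → ℕ → ℚ
binomial a zero    = 1ℚ
binomial a (suc n) = binomial a n * (a - fromℕ n) * (+ 1 / suc n)

-- The binomial series (1 + lt)ᵃ.
[1+_t]^_ : ℚ → ℚ → Series
([1+ l t]^ a) n = binomial a n * l ^ n

egf : (ℕ → ℚ) → Series
egf b k = b k * (+ 1 / k !)
  where
  instance _ = k ℕ.!≢0

-- (1 + lt)^{1/l} - 1, so that (∑ βₖ(l) tᵏ/k!) · denominator l = t determines
-- the degenerate Bernoulli numbers βₖ(l).
denominator : (l : ℚ) .{{_ : ℚ.NonZero l}} → Series
denominator l n = ([1+ l t]^ (1/ l)) n - 1ₛ n

-- Quotient of r by a series c with constant term 1.
_÷ₛ_ : Series → Series → Series
(r ÷ₛ c) zero    = r 0
(r ÷ₛ c) (suc n) = ((λ j → r (suc j) - r 0 * c (suc j)) ÷ₛ c) n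

÷ₛ-correct : ∀ r c → c 0 ≡ 1ℚ → (r ÷ₛ c) ⊛ c ≗ r
÷ₛ-correct r c c₀ zero    = trans (cong (r 0 *_) c₀) (ℚ.*-identityʳ (r 0))
÷ₛ-correct r c c₀ (suc n) = trans (cong (λ z → r 0 * c (suc n) + z) (÷ₛ-correct _ c c₀ n))
  (solve 2 (λ x y → y :+ (x :- y) := x) refl (r (suc n)) (r 0 * c (suc n)))

⊛-cong : ∀ {a a′ b b′} → a ≗ a′ → b ≗ b′ → a ⊛ b ≗ a′ ⊛ b′
⊛-cong a≗ b≗ zero    = cong₂ _*_ (a≗ 0) (b≗ 0)
⊛-cong a≗ b≗ (suc n) = cong₂ _+_ (cong₂ _*_ (a≗ 0) (b≗ (suc n))) (⊛-cong (a≗ ∘ suc) b≗ n)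

⊛-cancelʳ : ∀ a a′ c → c 0 ≡ 1ℚ → a ⊛ c ≗ a′ ⊛ c → a ≗ a′
⊛-cancelʳ a a′ c c₀ eq zero = begin
  a 0          ≡⟨ ℚ.*-identityʳ _ ⟨
  a 0 * 1ℚ     ≡⟨ cong (a 0 *_) c₀ ⟨
  a 0 * c 0    ≡⟨ eq 0 ⟩
  a′ 0 * c 0   ≡⟨ cong (a′ 0 *_) c₀ ⟩
  a′ 0 * 1ℚ    ≡⟨ ℚ.*-identityʳ _ ⟩
  a′ 0         ∎
⊛-cancelʳ a a′ c c₀ eq (suc n) = ⊛-cancelʳ (a ∘ suc) (a′ ∘ suc) c c₀ eq′ n
  where
  eq′ : (a ∘ suc) ⊛ c ≗ (a′ ∘ suc) ⊛ c
  eq′ j = +-cancelˡ (a 0 * c (suc j)) _ _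
    (trans (eq (suc j)) (cong (λ z → z * c (suc j) + ((a′ ∘ suc) ⊛ c) j) (sym (⊛-cancelʳ a a′ c c₀ eq 0))))

⊛-tail : ∀ a d → d 0 ≡ 0ℚ → ∀ n → (a ⊛ d) (suc n) ≡ (a ⊛ (d ∘ suc)) n
⊛-tail a d d₀ zero    = trans (cong (λ z → a 0 * d 1 + a 1 * z) d₀)
  (solve 2 (λ x y → x :+ y :* con 0ℚ := x) refl (a 0 * d 1) (a 1))
⊛-tail a d d₀ (suc n) = cong (λ z → a 0 * d (suc (suc n)) + z) (⊛-tail (a ∘ suc) d d₀ n)

denominator₁ : ∀ l .{{_ : ℚ.NonZero l}} → denominator l 1 ≡ 1ℚ
denominator₁ l = begin
  1ℚ * (1/ l - 0ℚ) * 1ℚ * (l * 1ℚ) - 0ℚ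
    ≡⟨ solve 2 (λ x y → con 1ℚ :* (x :- con 0ℚ) :* con 1ℚ :* (y :* con 1ℚ) :- con 0ℚ := x :* y) refl (1/ l) l ⟩
  1/ l * l
    ≡⟨ ℚ.*-inverseˡ l ⟩
  1ℚ ∎

∃!β : ∀ l .{{_ : ℚ.NonZero l}} → ∃! _≗_ λ b → egf b ⊛ denominator l ≗ tₛ
∃!β l = b , correct , λ {b′} → unique b′
  where
  c = denominator l ∘ suc
  b : ℕ → ℚ
  b k = (1ₛ ÷ₛ c) k * fromℕ (k !)

  1/k!*k!≡1 : ∀ k → egf (λ k → fromℕ (k !)) k ≡ 1ℚ
  1/k!*k!≡1 k = trans (ℚ.*-comm (fromℕ (k !)) _) (1/n*n≡1 (k !))
    where
    instance _ = k ℕ.!≢0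

  egf-b : egf b ≗ 1ₛ ÷ₛ c
  egf-b k = trans (ℚ.*-assoc ((1ₛ ÷ₛ c) k) (fromℕ (k !)) _)
    (trans (cong ((1ₛ ÷ₛ c) k *_) (1/k!*k!≡1 k)) (ℚ.*-identityʳ _))

  correct : egf b ⊛ denominator l ≗ tₛ
  correct zero    = ℚ.*-zeroʳ (egf b 0)
  correct (suc n) = begin
    (egf b ⊛ denominator l) (suc n)  ≡⟨ ⊛-tail (egf b) (denominator l) refl n ⟩
    (egf b ⊛ c) n                    ≡⟨ ⊛-cong {b = c} egf-b (λ _ → refl) n ⟩
    ((1ₛ ÷ₛ c) ⊛ c) n                ≡⟨ ÷ₛ-correct 1ₛ c (denominator₁ l) n ⟩
    1ₛ n                             ∎

  egf-injective : ∀ b b′ k → egf b k ≡ egf b′ k → b k ≡ b′ k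
  egf-injective b b′ k eq = begin
    b k                                  ≡⟨ expand (b k) ⟩
    egf b k * fromℕ (k !)                ≡⟨ cong (_* fromℕ (k !)) eq ⟩
    egf b′ k * fromℕ (k !)               ≡⟨ expand (b′ k) ⟨
    b′ k                                 ∎
    where
    instance _ = k ℕ.!≢0
    expand : ∀ x → x ≡ x * (+ 1 / k !) * fromℕ (k !)
    expand x = sym (trans (ℚ.*-assoc x _ _) (trans (cong (x *_) (1/n*n≡1 (k !))) (ℚ.*-identityʳ x)))

  unique : ∀ b′ → egf b′ ⊛ denominator l ≗ tₛ → b ≗ b′
  unique b′ eq k = egf-injective b b′ k
    (⊛-cancelʳ (egf b) (egf b′) c (denominator₁ l)
      (λ n → trans (sym (⊛-tail (egf b) (denominator l) refl n))
             (trans (correct (suc n)) (trans (sym (eq (suc n))) (⊛-tail (egf b′) (denominator l) refl n)))) k)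

β : ℕ → (l : ℚ) .{{_ : ℚ.NonZero l}} → ℚ
β k l = proj₁ (∃!β l) k

1/n-nonZero : ∀ n .{{_ : ℕ.NonZero n}} → ℚ.NonZero (+ 1 / n)
1/n-nonZero n = ℚ.pos⇒nonZero (+ 1 / n) {{ℚ.normalize-pos 1 n}}

β̃ : (k m : ℕ) .{{_ : ℕ.NonZero m}} → ℚ
β̃ k m = fromℕ m ^ k * β k (+ 1 / m) {{1/n-nonZero m}}

-- Modulo Ψ m the substitution x ↦ 1/x sends 1 - x to -(1 - x)/x, so it sends
-- p = (1 - x)⁻ᵏ to (-1)ᵏxᵏp.  For k = md + 2 this is (-1)ᵈx²p, as m is odd and xᵐ ≡ 1, and
-- deg p ≤ m - 2 turns the congruence into an equality of coefficients.
--
-- To work with coefficients only, p is read as an m-periodic function F on ℤ up to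
-- an additive constant (the multiples of Ψ m).  Multiplication by 1 - x is then
-- the difference operator, whose kernel on periodic functions modulo constants is
-- zero, so that the reflection formula propagates from k = 0 to all integers k.
--
-- For the numbers, put x = 1 + u.  The recurrence fₖ = (1 - x)fₖ₊₁ + cΨ is the long
-- division of 1 by Ψ(1 + u)/m, so β̃ₖ(m)/k! = (-1)ᵏfₖ(1) for k ≥ 1, and antipalindromic
-- polynomials vanish at 1.

module Submission where

open import Defs
open import Data.Integer.Base as ℤ using (ℤ; -[1+_])
open import Data.Integer.Divisibility.Signed using (∣⇒∣ᵤ; divides)
import Data.Integer.Properties as ℤ
open import Data.Integer.Tactic.RingSolver using (solve-∀)
open import Data.List.Base using ([]; _∷_)
open import Data.Nat.Base as ℕ using (ℕ; zero; suc; s≤s; z≤n; _!)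
open import Data.Nat.Divisibility using (>⇒∤) renaming (_∣_ to _∣ℕ_)
import Data.Nat.Properties as ℕ
open import Data.Product using (∃; _×_; _,_; proj₁; proj₂)
open import Data.Rational.Base as ℚ using (ℚ; 0ℚ; 1ℚ)
import Data.Rational.Properties as ℚ
open import Data.Rational.Solver using (module +-*-Solver)
open import Function.Base using (_∘_)
open import Level using (0ℓ)
open import Relation.Binary.Bundles using (Setoid)
open import Relation.Binary.PropositionalEquality
import Relation.Binary.Reasoning.Setoid as SetoidReasoning
open import Relation.Nullary using (¬_; yes; no; contradiction)
open +-*-Solver using (solve; con; _:=_; _:+_; _:*_; _:-_; :-_)

-- Ring laws of ℚ[x] and congruences modulo a polynomial.

module Polynomials where

  open import Data.Rational.Base using (_+_; _*_; _-_; -_)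
  open ≡-Reasoning

  ·-⊗ : ∀ c t q j → coeff ((c · t) ⊗ q) j ≡ c * coeff (t ⊗ q) j
  ·-⊗ c t q j = trans (⊕-⊗ c [] t q j) (ℚ.+-identityˡ _)

  shift-cong : ∀ {p q} → p ≈ q → ∀ j → shift p j ≡ shift q j
  shift-cong p≈q zero    = refl
  shift-cong p≈q (suc j) = p≈q j

  ⊗-congʳ : ∀ p {q r} → q ≈ r → p ⊗ q ≈ p ⊗ r
  ⊗-congʳ []      q≈r j = refl
  ⊗-congʳ (a ∷ p) {q} {r} q≈r j = begin
    coeff ((a ∷ p) ⊗ q) j              ≡⟨ coeff-∷⊗ a p q j ⟩
    a * coeff q j + shift (p ⊗ q) j    ≡⟨ cong₂ (λ y z → a * y + z) (q≈r j) (shift-cong {p ⊗ q} {p ⊗ r} (⊗-congʳ p q≈r) j) ⟩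
    a * coeff r j + shift (p ⊗ r) j    ≡⟨ coeff-∷⊗ a p r j ⟨
    coeff ((a ∷ p) ⊗ r) j              ∎

  ⊗-zeroʳ : ∀ p j → coeff (p ⊗ []) j ≡ 0ℚ
  ⊗-zeroʳ []      j       = refl
  ⊗-zeroʳ (a ∷ p) zero    = refl
  ⊗-zeroʳ (a ∷ p) (suc j) = ⊗-zeroʳ p j

  ⊗-∷ : ∀ p b q j → coeff (p ⊗ (b ∷ q)) j ≡ b * coeff p j + shift (p ⊗ q) j
  ⊗-∷ []      b q zero    = solve 1 (λ b → con 0ℚ := b :* con 0ℚ :+ con 0ℚ) refl b
  ⊗-∷ []      b q (suc j) = solve 1 (λ b → con 0ℚ := b :* con 0ℚ :+ con 0ℚ) refl b
  ⊗-∷ (a ∷ p) b q zero    = solve 2 (λ a b → a :* b :+ con 0ℚ := b :* a :+ con 0ℚ) refl a b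
  ⊗-∷ (a ∷ p) b q (suc j) = begin
    coeff ((a ∷ p) ⊗ (b ∷ q)) (suc j)
      ≡⟨ coeff-∷⊗ a p (b ∷ q) (suc j) ⟩
    a * coeff q j + coeff (p ⊗ (b ∷ q)) j
      ≡⟨ cong (λ z → a * coeff q j + z) (⊗-∷ p b q j) ⟩
    a * coeff q j + (b * coeff p j + shift (p ⊗ q) j)
      ≡⟨ solve 3 (λ x y z → x :+ (y :+ z) := y :+ (x :+ z)) refl (a * coeff q j) (b * coeff p j) (shift (p ⊗ q) j) ⟩
    b * coeff p j + (a * coeff q j + shift (p ⊗ q) j)
      ≡⟨ cong (λ z → b * coeff p j + z) (coeff-∷⊗ a p q j) ⟨
    b * coeff p j + coeff ((a ∷ p) ⊗ q) j ∎

  ⊗-comm : ∀ p q → p ⊗ q ≈ q ⊗ p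
  ⊗-comm []      q j = sym (⊗-zeroʳ q j)
  ⊗-comm (a ∷ p) q j = begin
    coeff ((a ∷ p) ⊗ q) j              ≡⟨ coeff-∷⊗ a p q j ⟩
    a * coeff q j + shift (p ⊗ q) j    ≡⟨ cong (λ z → a * coeff q j + z) (shift-cong {p ⊗ q} {q ⊗ p} (⊗-comm p q) j) ⟩
    a * coeff q j + shift (q ⊗ p) j    ≡⟨ ⊗-∷ q a p j ⟨
    coeff (q ⊗ (a ∷ p)) j              ∎

  ⊗-congˡ : ∀ {p q} r → p ≈ q → p ⊗ r ≈ q ⊗ r
  ⊗-congˡ {p} {q} r p≈q j = trans (⊗-comm p r j) (trans (⊗-congʳ r {p} {q} p≈q j) (⊗-comm r q j))

  ⊗-distribʳ : ∀ r p q j → coeff ((p ⊕ q) ⊗ r) j ≡ coeff (p ⊗ r) j + coeff (q ⊗ r) j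
  ⊗-distribʳ r p q j = begin
    coeff ((p ⊕ q) ⊗ r) j                    ≡⟨ ⊗-congˡ {p ⊕ q} {p ⊕ 1ℚ · q} r unit j ⟩
    coeff ((p ⊕ 1ℚ · q) ⊗ r) j               ≡⟨ ⊕-⊗ 1ℚ p q r j ⟩
    coeff (p ⊗ r) j + 1ℚ * coeff (q ⊗ r) j   ≡⟨ cong (coeff (p ⊗ r) j +_) (ℚ.*-identityˡ _) ⟩
    coeff (p ⊗ r) j + coeff (q ⊗ r) j        ∎
    where
    unit : p ⊕ q ≈ p ⊕ 1ℚ · q
    unit i = begin
      coeff (p ⊕ q) i                  ≡⟨ coeff-⊕ p q i ⟩
      coeff p i + coeff q i            ≡⟨ cong (coeff p i +_) (trans (coeff-· 1ℚ q i) (ℚ.*-identityˡ _)) ⟨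
      coeff p i + coeff (1ℚ · q) i     ≡⟨ coeff-⊕ p (1ℚ · q) i ⟨
      coeff (p ⊕ 1ℚ · q) i             ∎

  ⊗-assoc : ∀ p q r → (p ⊗ q) ⊗ r ≈ p ⊗ (q ⊗ r)
  ⊗-assoc []      q r j = refl
  ⊗-assoc (a ∷ p) q r j = begin
    coeff ((a · q ⊕ (0ℚ ∷ p ⊗ q)) ⊗ r) j
      ≡⟨ ⊗-distribʳ r (a · q) (0ℚ ∷ p ⊗ q) j ⟩
    coeff ((a · q) ⊗ r) j + coeff ((0ℚ ∷ p ⊗ q) ⊗ r) j
      ≡⟨ cong₂ _+_ (·-⊗ a q r j) (coeff-∷⊗ 0ℚ (p ⊗ q) r j) ⟩
    a * coeff (q ⊗ r) j + (0ℚ * coeff r j + shift ((p ⊗ q) ⊗ r) j)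
      ≡⟨ cong (λ z → a * coeff (q ⊗ r) j + (0ℚ * coeff r j + z)) (shift-cong {(p ⊗ q) ⊗ r} {p ⊗ (q ⊗ r)} (⊗-assoc p q r) j) ⟩
    a * coeff (q ⊗ r) j + (0ℚ * coeff r j + shift (p ⊗ (q ⊗ r)) j)
      ≡⟨ solve 3 (λ x y z → x :+ (con 0ℚ :* y :+ z) := x :+ z) refl (a * coeff (q ⊗ r) j) (coeff r j) (shift (p ⊗ (q ⊗ r)) j) ⟩
    a * coeff (q ⊗ r) j + shift (p ⊗ (q ⊗ r)) j
      ≡⟨ coeff-∷⊗ a p (q ⊗ r) j ⟨
    coeff ((a ∷ p) ⊗ (q ⊗ r)) j ∎

  ⊗-identityˡ : ∀ p → 1ₚ ⊗ p ≈ p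
  ⊗-identityˡ p j = begin
    coeff (1ₚ ⊗ p) j                 ≡⟨ coeff-∷⊗ 1ℚ [] p j ⟩
    1ℚ * coeff p j + shift [] j      ≡⟨ cong (1ℚ * coeff p j +_) (coeff-0∷[] j) ⟩
    1ℚ * coeff p j + 0ℚ              ≡⟨ solve 1 (λ x → con 1ℚ :* x :+ con 0ℚ := x) refl (coeff p j) ⟩
    coeff p j                        ∎

  ≈⇒mod : ∀ {p q} r → p ≈ q → p ≡ q [mod r ]
  ≈⇒mod {p} {q} r p≈q = [] , λ j → trans (p≈q j) (sym (trans (coeff-⊕ q [] j) (ℚ.+-identityʳ _)))

  mod-sym : ∀ {p q} r → p ≡ q [mod r ] → q ≡ p [mod r ]
  mod-sym {p} {q} r (s , p≈) = (- 1ℚ) · s , λ j → begin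
    coeff q j
      ≡⟨ solve 2 (λ x y → x := x :+ y :+ con (- 1ℚ) :* y) refl (coeff q j) (coeff (s ⊗ r) j) ⟩
    coeff q j + coeff (s ⊗ r) j + (- 1ℚ) * coeff (s ⊗ r) j
      ≡⟨ cong₂ _+_ (sym (trans (p≈ j) (coeff-⊕ q _ j))) (sym (·-⊗ (- 1ℚ) s r j)) ⟩
    coeff p j + coeff (((- 1ℚ) · s) ⊗ r) j
      ≡⟨ coeff-⊕ p _ j ⟨
    coeff (p ⊕ ((- 1ℚ) · s) ⊗ r) j ∎

  mod-trans : ∀ {p q u} r → p ≡ q [mod r ] → q ≡ u [mod r ] → p ≡ u [mod r ]
  mod-trans {p} {q} {u} r (s , p≈) (t , q≈) = s ⊕ t , λ j → begin
    coeff p j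
      ≡⟨ trans (p≈ j) (coeff-⊕ q _ j) ⟩
    coeff q j + coeff (s ⊗ r) j
      ≡⟨ cong (_+ coeff (s ⊗ r) j) (trans (q≈ j) (coeff-⊕ u _ j)) ⟩
    coeff u j + coeff (t ⊗ r) j + coeff (s ⊗ r) j
      ≡⟨ solve 3 (λ x y z → x :+ y :+ z := x :+ (z :+ y)) refl (coeff u j) (coeff (t ⊗ r) j) (coeff (s ⊗ r) j) ⟩
    coeff u j + (coeff (s ⊗ r) j + coeff (t ⊗ r) j)
      ≡⟨ cong (coeff u j +_) (⊗-distribʳ r s t j) ⟨
    coeff u j + coeff ((s ⊕ t) ⊗ r) j
      ≡⟨ coeff-⊕ u _ j ⟨
    coeff (u ⊕ (s ⊕ t) ⊗ r) j ∎

  mod-⊗ʳ : ∀ {p q} r u → p ≡ q [mod r ] → u ⊗ p ≡ u ⊗ q [mod r ]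
  mod-⊗ʳ {p} {q} r u (s , p≈) = u ⊗ s , λ j → begin
    coeff (u ⊗ p) j
      ≡⟨ ⊗-comm u p j ⟩
    coeff (p ⊗ u) j
      ≡⟨ ⊗-congˡ {p} {q ⊕ s ⊗ r} u p≈ j ⟩
    coeff ((q ⊕ s ⊗ r) ⊗ u) j
      ≡⟨ ⊗-distribʳ u q (s ⊗ r) j ⟩
    coeff (q ⊗ u) j + coeff ((s ⊗ r) ⊗ u) j
      ≡⟨ cong₂ _+_ (⊗-comm q u j) (trans (⊗-comm (s ⊗ r) u j) (sym (⊗-assoc u s r j))) ⟩
    coeff (u ⊗ q) j + coeff ((u ⊗ s) ⊗ r) j
      ≡⟨ coeff-⊕ (u ⊗ q) _ j ⟨
    coeff (u ⊗ q ⊕ (u ⊗ s) ⊗ r) j ∎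

  -- Both `p` and (1 - x)`q` have degree at most n, and `Ψ (suc n)` has degree exactly n, so the
  -- cofactor in the congruence must be a constant. The bound on `p` is n instead of n - 1 in order
  -- to admit p = 1 when n = 0.
  mod-degree≤ : ∀ n {p q} → degree p < suc n → degree q < n → p ≡ 1-x ⊗ q [mod Ψ (suc n) ] →
    ∃ λ c → ∀ j → coeff p j ≡ coeff q j - shift q j + c * coeff (Ψ (suc n)) j
  mod-degree≤ n {p} {q} deg-p deg-q (s , p≈) = c , λ j → begin
    coeff p j
      ≡⟨ p-coeff j ⟩
    Q j + S j
      ≡⟨ solve 3 (λ x y z → x :+ y := x :+ z :+ (y :+ con (- 1ℚ) :* z)) refl (Q j) (S j) (c * coeff Ψₙ j) ⟩
    Q j + c * coeff Ψₙ j + (S j + (- 1ℚ) * (c * coeff Ψₙ j))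
      ≡⟨ cong (Q j + c * coeff Ψₙ j +_) (trans (sym (t-coeff j)) (multiple-zero n t deg-t j)) ⟩
    Q j + c * coeff Ψₙ j + 0ℚ
      ≡⟨ ℚ.+-identityʳ _ ⟩
    Q j + c * coeff Ψₙ j ∎
    where
    Ψₙ = Ψ (suc n)
    Q S : ℕ → ℚ
    Q j = coeff q j - shift q j
    S = coeff (s ⊗ Ψₙ)
    -- As `Ψₙ` has coefficient 1 at xⁿ, subtracting `c` times `Ψₙ` cancels the top term of `s ⊗ Ψₙ`.
    -- The multiple of `Ψₙ` that is left has degree below n and vanishes by `multiple-zero`.
    c = S n
    t = s ⊕ (- 1ℚ) · (c ∷ [])

    p-coeff : ∀ j → coeff p j ≡ Q j + S j
    p-coeff j = trans (p≈ j) (trans (coeff-⊕ (1-x ⊗ q) _ j) (cong (_+ S j) (coeff-[1-x]⊗ q j)))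

    c-coeff : ∀ j → coeff ((c ∷ []) ⊗ Ψₙ) j ≡ c * coeff Ψₙ j
    c-coeff j = trans (coeff-∷⊗ c [] Ψₙ j) (trans (cong (c * coeff Ψₙ j +_) (coeff-0∷[] j)) (ℚ.+-identityʳ _))

    t-coeff : ∀ j → coeff (t ⊗ Ψₙ) j ≡ S j + (- 1ℚ) * (c * coeff Ψₙ j)
    t-coeff j = trans (⊕-⊗ (- 1ℚ) s (c ∷ []) Ψₙ j) (cong (λ z → S j + (- 1ℚ) * z) (c-coeff j))

    S-high : ∀ j → suc n ℕ.≤ j → S j ≡ 0ℚ
    S-high (suc j) (s≤s n≤j) = begin
      S (suc j)
        ≡⟨ solve 1 (λ x → x := con 0ℚ :- con 0ℚ :+ x) refl (S (suc j)) ⟩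
      0ℚ - 0ℚ + S (suc j)
        ≡⟨ cong₂ (λ y z → y - z + S (suc j)) (deg-q (suc j) (ℕ.m≤n⇒m≤1+n n≤j)) (deg-q j n≤j) ⟨
      Q (suc j) + S (suc j)
        ≡⟨ p-coeff (suc j) ⟨
      coeff p (suc j)
        ≡⟨ deg-p (suc j) (s≤s n≤j) ⟩
      0ℚ ∎

    deg-t : degree t ⊗ Ψₙ < n
    deg-t j n≤j with n ℕ.≟ j
    ... | yes refl = begin
      coeff (t ⊗ Ψₙ) n                       ≡⟨ t-coeff n ⟩
      c + (- 1ℚ) * (c * coeff Ψₙ n)          ≡⟨ cong (λ z → c + (- 1ℚ) * (c * z)) (coeff-Ψ< (ℕ.n<1+n n)) ⟩
      c + (- 1ℚ) * (c * 1ℚ)                  ≡⟨ solve 1 (λ c → c :+ con (- 1ℚ) :* (c :* con 1ℚ) := con 0ℚ) refl c ⟩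
      0ℚ                                     ∎
    ... | no n≢j = begin
      coeff (t ⊗ Ψₙ) j                       ≡⟨ t-coeff j ⟩
      S j + (- 1ℚ) * (c * coeff Ψₙ j)        ≡⟨ cong₂ (λ y z → y + (- 1ℚ) * (c * z)) (S-high j n<j) (coeff-Ψ≥ n<j) ⟩
      0ℚ + (- 1ℚ) * (c * 0ℚ)                 ≡⟨ solve 1 (λ c → con 0ℚ :+ con (- 1ℚ) :* (c :* con 0ℚ) := con 0ℚ) refl c ⟩
      0ℚ                                     ∎
      where n<j = ℕ.≤∧≢⇒< n≤j n≢j

-- Integer powers of 1 - x modulo `Ψ m`.

module Congruence where

  open Polynomials

  modSetoid : Poly → Setoid 0ℓ 0ℓ
  modSetoid r = record
    { Carrier       = Poly
    ; _≈_           = _≡_[mod r ]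
    ; isEquivalence = record
      { refl  = λ {p} → ≈⇒mod {p} {p} r λ _ → refl
      ; sym   = λ {p} {q} → mod-sym {p} {q} r
      ; trans = λ {p} {q} {u} → mod-trans {p} {q} {u} r
      }
    }

  -- For `k` ≥ 0 the powers are those of `inverse[1-x] m`, and a factor (1 - x) · `inverse[1-x] m` ≡
  -- 1 is inserted. For negative `k` both sides compute to the same ordinary power of 1 - x.
  [1-x]^-suc : ∀ m .{{_ : ℕ.NonZero m}} k →
    [1-x]^ m (ℤ.- k) ≡ 1-x ⊗ [1-x]^ m (ℤ.- ℤ.suc k) [mod Ψ m ]
  [1-x]^-suc m (ℤ.+ n) = begin
    [1-x]^ m (ℤ.- ℤ.+ n)   ≡⟨ power n ⟨
    w                      ≈⟨ ≈⇒mod {w} {w ⊗ 1ₚ} (Ψ m) (λ j → sym (trans (⊗-comm w 1ₚ j) (⊗-identityˡ w j))) ⟩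
    w ⊗ 1ₚ                 ≈⟨ mod-⊗ʳ {1-x ⊗ i} {1ₚ} (Ψ m) w (inverse[1-x]-correct m) ⟨
    w ⊗ (1-x ⊗ i)          ≈⟨ ≈⇒mod {1-x ⊗ (i ⊗ w)} {w ⊗ (1-x ⊗ i)} (Ψ m) regroup ⟨
    1-x ⊗ (i ⊗ w)          ∎
    where
    open SetoidReasoning (modSetoid (Ψ m))
    i = inverse[1-x] m
    w = i ^ₚ n
    regroup : 1-x ⊗ (i ⊗ w) ≈ w ⊗ (1-x ⊗ i)
    regroup j = trans (sym (⊗-assoc 1-x i w j)) (⊗-comm (1-x ⊗ i) w j)
    -- `ℤ.- ℤ.+ n` reduces only after `n` is split, so the two clauses of `[1-x]^` are matched by
    -- cases.
    power : ∀ n → i ^ₚ n ≡ [1-x]^ m (ℤ.- ℤ.+ n)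
    power zero    = refl
    power (suc n) = refl
  [1-x]^-suc m -[1+ zero  ] = Setoid.refl (modSetoid (Ψ m)) {1-x ^ₚ 1}
  [1-x]^-suc m -[1+ suc n ] = Setoid.refl (modSetoid (Ψ m)) {1-x ^ₚ suc (suc n)}

  f-degree : ∀ m .{{_ : ℕ.NonZero m}} k → degree f m k < m ℕ.∸ 1
  f-degree m k = proj₁ (proj₁ (proj₂ (∃!f m k)))

  f-mod : ∀ m .{{_ : ℕ.NonZero m}} k → f m k ≡ [1-x]^ m (ℤ.- k) [mod Ψ m ]
  f-mod m k = proj₂ (proj₁ (proj₂ (∃!f m k)))

  -- The left side is the power itself and not `f m k`, so that the congruence also serves for `f′`,
  -- whose member of index 0 is 1.
  f-mod-suc : ∀ m .{{_ : ℕ.NonZero m}} k → [1-x]^ m (ℤ.- k) ≡ 1-x ⊗ f m (ℤ.suc k) [mod Ψ m ]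
  f-mod-suc m k = begin
    [1-x]^ m (ℤ.- k)                  ≈⟨ [1-x]^-suc m k ⟩
    1-x ⊗ [1-x]^ m (ℤ.- ℤ.suc k)      ≈⟨ mod-⊗ʳ {f m (ℤ.suc k)} {[1-x]^ m (ℤ.- ℤ.suc k)} (Ψ m) 1-x (f-mod m (ℤ.suc k)) ⟨
    1-x ⊗ f m (ℤ.suc k)               ∎
    where open SetoidReasoning (modSetoid (Ψ m))

-- Reindexing identities in ℤ.

module IntegerIdentities where

  open import Data.Integer.Base using (_+_; _*_; _-_; -_)

  suc-shift : ∀ r x → ℤ.1ℤ + (r + x) ≡ ℤ.1ℤ + r + x
  suc-shift = solve-∀

  suc-wrap : ∀ n q → ℤ.1ℤ + (n + q * (ℤ.1ℤ + n)) ≡ ℤ.0ℤ + (ℤ.1ℤ + q) * (ℤ.1ℤ + n)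
  suc-wrap = solve-∀

  add-multiple : ∀ r q q′ m → r + q * m + q′ * m ≡ r + (q + q′) * m
  add-multiple = solve-∀

  neg-multiple : ∀ q m → ℤ.0ℤ - (ℤ.0ℤ + q * m) ≡ ℤ.0ℤ + (- q) * m
  neg-multiple = solve-∀

  reflect-suc-index : ∀ k j → ℤ.1ℤ + (- (ℤ.1ℤ + k) - (ℤ.1ℤ + j)) ≡ - k - (ℤ.1ℤ + j)
  reflect-suc-index = solve-∀

  reflect-suc : ∀ k j → ℤ.1ℤ + (- (ℤ.1ℤ + k) - (ℤ.1ℤ + j)) ≡ - (ℤ.1ℤ + k) - j
  reflect-suc = solve-∀

  reflect-period : ∀ k m → - k - m ≡ - k - ℤ.0ℤ + (- ℤ.1ℤ) * m
  reflect-period = solve-∀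

  last-residue : ∀ n → - ℤ.1ℤ ≡ n + (- ℤ.1ℤ) * (ℤ.1ℤ + n)
  last-residue = solve-∀

  -- With m = 1 + n and k = md + 2, the reflection j ↦ -k - j preserves the residue class of -1
  -- modulo m.
  reflect-last : ∀ n d → - ((ℤ.1ℤ + n) * d + (ℤ.1ℤ + ℤ.1ℤ)) - (- ℤ.1ℤ) ≡ n + (- d - ℤ.1ℤ) * (ℤ.1ℤ + n)
  reflect-last = solve-∀

  -- With k = md + 2 the reflection j ↦ -k - j sends the residue i to m - 2 - i. Writing m as 2 + i
  -- + e replaces the truncated subtraction by a variable that the ring solver can handle.
  reflect-residue : ∀ i e d → - ((ℤ.1ℤ + (ℤ.1ℤ + i + e)) * d + (ℤ.1ℤ + ℤ.1ℤ)) - i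
                               ≡ e + (- d - ℤ.1ℤ) * (ℤ.1ℤ + (ℤ.1ℤ + i + e))
  reflect-residue = solve-∀

-- Coefficients as periodic functions on ℤ, and the difference operator.

module PeriodicExtension where

  open import Data.Integer.DivMod using (_%ℕ_; _/ℕ_; n%ℕd<d; a≡a%ℕn+[a/ℕn]*n)
  open import Data.Rational.Base using (_+_; _*_; _-_; -_)
  open IntegerIdentities
  open ≡-Reasoning

  -- Two remainders of the same integer differ by a multiple of `m` whose absolute value is below
  -- `m`, hence by 0.
  %ℕ-unique : ∀ m .{{_ : ℕ.NonZero m}} r q → r ℕ.< m → (ℤ.+ r ℤ.+ q ℤ.* ℤ.+ m) %ℕ m ≡ r
  %ℕ-unique m r q r<m = ℤ.+-injective (ℤ.i-j≡0⇒i≡j (ℤ.+ r′) (ℤ.+ r) (ℤ.∣i∣≡0⇒i≡0 (small _ m∣ <m)))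
    where
    j  = ℤ.+ r ℤ.+ q ℤ.* ℤ.+ m
    r′ = j %ℕ m
    small : ∀ x → m ∣ℕ x → x ℕ.< m → x ≡ 0
    small zero    _   _   = refl
    small (suc x) m∣x x<m = contradiction m∣x (>⇒∤ x<m)
    difference : ∀ r r′ q q′ m → r ℤ.+ q ℤ.* m ≡ r′ ℤ.+ q′ ℤ.* m → r′ ℤ.- r ≡ (q ℤ.- q′) ℤ.* m
    difference r r′ q q′ m eq = begin
      r′ ℤ.- r                                         ≡⟨ add-cancel r′ r (q′ ℤ.* m) ⟩
      r′ ℤ.+ q′ ℤ.* m ℤ.- (r ℤ.+ q′ ℤ.* m)             ≡⟨ cong (ℤ._- (r ℤ.+ q′ ℤ.* m)) eq ⟨
      r ℤ.+ q ℤ.* m ℤ.- (r ℤ.+ q′ ℤ.* m)               ≡⟨ collect r q q′ m ⟩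
      (q ℤ.- q′) ℤ.* m                                 ∎
      where
      add-cancel : ∀ a b c → a ℤ.- b ≡ a ℤ.+ c ℤ.- (b ℤ.+ c)
      add-cancel = solve-∀
      collect : ∀ r q q′ m → r ℤ.+ q ℤ.* m ℤ.- (r ℤ.+ q′ ℤ.* m) ≡ (q ℤ.- q′) ℤ.* m
      collect = solve-∀
    m∣ : m ∣ℕ ℤ.∣ ℤ.+ r′ ℤ.- ℤ.+ r ∣
    m∣ = ∣⇒∣ᵤ (divides (q ℤ.- j /ℕ m) (difference (ℤ.+ r) (ℤ.+ r′) q (j /ℕ m) (ℤ.+ m) (a≡a%ℕn+[a/ℕn]*n j m)))
    <m : ℤ.∣ ℤ.+ r′ ℤ.- ℤ.+ r ∣ ℕ.< m
    <m rewrite ℤ.m-n≡m⊖n r′ r = ℕ.≤-<-trans (ℤ.∣m⊝n∣≤m⊔n r′ r) (ℕ.⊔-pres-<m (n%ℕd<d j m) r<m)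

  -- For degree p < m, the coefficients of p mod xᵐ - 1, indexed by ℤ/m.
  periodic : (m : ℕ) .{{_ : ℕ.NonZero m}} → Poly → ℤ → ℚ
  periodic m p j = coeff p (j %ℕ m)

  periodic-residue : ∀ m .{{_ : ℕ.NonZero m}} p {r} q → r ℕ.< m → periodic m p (ℤ.+ r ℤ.+ q ℤ.* ℤ.+ m) ≡ coeff p r
  periodic-residue m p q r<m = cong (coeff p) (%ℕ-unique m _ q r<m)

  periodic-+ : ∀ m .{{_ : ℕ.NonZero m}} p j q → periodic m p (j ℤ.+ q ℤ.* ℤ.+ m) ≡ periodic m p j
  periodic-+ m p j q = begin
    periodic m p (j ℤ.+ q ℤ.* ℤ.+ m)
      ≡⟨ cong (λ i → periodic m p (i ℤ.+ q ℤ.* ℤ.+ m)) (a≡a%ℕn+[a/ℕn]*n j m) ⟩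
    periodic m p (ℤ.+ (j %ℕ m) ℤ.+ (j /ℕ m) ℤ.* ℤ.+ m ℤ.+ q ℤ.* ℤ.+ m)
      ≡⟨ cong (periodic m p) (add-multiple (ℤ.+ (j %ℕ m)) (j /ℕ m) q (ℤ.+ m)) ⟩
    periodic m p (ℤ.+ (j %ℕ m) ℤ.+ (j /ℕ m ℤ.+ q) ℤ.* ℤ.+ m)
      ≡⟨ periodic-residue m p (j /ℕ m ℤ.+ q) (n%ℕd<d j m) ⟩
    periodic m p j ∎

  -- All coefficients of `Ψ (suc n)` up to degree n are 1, so over a full period it becomes the
  -- constant function and only `c` is left of its multiple.
  periodic-difference : ∀ n p q c → degree q < n →
    (∀ j → coeff p j ≡ coeff q j - shift q j + c * coeff (Ψ (suc n)) j) →
    ∀ j → periodic (suc n) p (ℤ.suc j) ≡ periodic (suc n) q (ℤ.suc j) - periodic (suc n) q j + c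
  periodic-difference n p q c deg rel j with j %ℕ suc n in j%m | n%ℕd<d j (suc n) | a≡a%ℕn+[a/ℕn]*n j (suc n)
  ... | r | r<m | j≡ with r ℕ.≟ n
  -- At the wrap-around from residue n to 0 the polynomial relation has `shift q 0`, which is 0,
  -- where the periodic one has `coeff q n`; the degree bound on `q` makes them agree.
  ... | yes refl = begin
    P (ℤ.suc j)                                     ≡⟨ at p ⟩
    coeff p 0                                       ≡⟨ rel 0 ⟩
    coeff q 0 - 0ℚ + c * 1ℚ                         ≡⟨ cong (λ z → coeff q 0 - z + c * 1ℚ) (deg n ℕ.≤-refl) ⟨
    coeff q 0 - coeff q n + c * 1ℚ                  ≡⟨ cong₂ (λ y z → y - coeff q n + z) (sym (at q)) (ℚ.*-identityʳ c) ⟩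
    periodic (suc n) q (ℤ.suc j) - coeff q n + c    ∎
    where
    P = periodic (suc n) p
    at : ∀ u → periodic (suc n) u (ℤ.suc j) ≡ coeff u 0
    at u = trans (cong (periodic (suc n) u) (trans (cong ℤ.suc j≡) (suc-wrap (ℤ.+ n) (j /ℕ suc n))))
                 (periodic-residue (suc n) u (ℤ.suc (j /ℕ suc n)) (s≤s z≤n))
  ... | no r≢n = begin
    P (ℤ.suc j)                                                ≡⟨ at p ⟩
    coeff p (suc r)                                            ≡⟨ rel (suc r) ⟩
    coeff q (suc r) - coeff q r + c * coeff (Ψ (suc n)) (suc r)
      ≡⟨ cong₂ (λ y z → y - coeff q r + c * z) (sym (at q)) (coeff-Ψ< {suc n} {suc r} 1+r<m) ⟩
    periodic (suc n) q (ℤ.suc j) - coeff q r + c * 1ℚ          ≡⟨ cong (λ z → periodic (suc n) q (ℤ.suc j) - coeff q r + z) (ℚ.*-identityʳ c) ⟩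
    periodic (suc n) q (ℤ.suc j) - coeff q r + c               ∎
    where
    P = periodic (suc n) p
    1+r<m : suc r ℕ.< suc n
    1+r<m = s≤s (ℕ.≤∧≢⇒< (ℕ.≤-pred r<m) r≢n)
    at : ∀ u → periodic (suc n) u (ℤ.suc j) ≡ coeff u (suc r)
    at u = trans (cong (periodic (suc n) u) (trans (cong ℤ.suc j≡) (suc-shift (ℤ.+ r) ((j /ℕ suc n) ℤ.* ℤ.+ suc n))))
                 (periodic-residue (suc n) u (j /ℕ suc n) 1+r<m)

  -- Over one period `H` grows by (n + 1)`c`, yet it returns to its starting value, so `c` = 0 after
  -- division by n + 1. This is the injectivity of the difference operator on periodic functions
  -- modulo constants.
  constant-difference⇒constant : ∀ n (H : ℤ → ℚ) c → (∀ j → H (ℤ.suc j) ≡ H j + c) →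
    H (ℤ.+ suc n) ≡ H (ℤ.+ 0) → ∀ j → H j ≡ H (ℤ.+ 0)
  constant-difference⇒constant n H c step period = constant
    where
    linear : ∀ i → H (ℤ.+ i) ≡ H (ℤ.+ 0) + fromℕ i * c
    linear zero    = solve 2 (λ x c → x := x :+ con 0ℚ :* c) refl (H (ℤ.+ 0)) c
    linear (suc i) = begin
      H (ℤ.+ suc i)                           ≡⟨ step (ℤ.+ i) ⟩
      H (ℤ.+ i) + c                           ≡⟨ cong (_+ c) (linear i) ⟩
      H (ℤ.+ 0) + fromℕ i * c + c             ≡⟨ solve 3 (λ x y c → x :+ y :* c :+ c := x :+ (con 1ℚ :+ y) :* c) refl (H (ℤ.+ 0)) (fromℕ i) c ⟩
      H (ℤ.+ 0) + (1ℚ + fromℕ i) * c          ≡⟨ cong (λ z → H (ℤ.+ 0) + z * c) (fromℕ-suc i) ⟨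
      H (ℤ.+ 0) + fromℕ (suc i) * c           ∎

    c≡0 : c ≡ 0ℚ
    c≡0 = begin
      c                                       ≡⟨ ℚ.*-identityˡ c ⟨
      1ℚ * c                                  ≡⟨ cong (_* c) (1/n*n≡1 (suc n)) ⟨
      ℤ.1ℤ ℚ./ suc n * fromℕ (suc n) * c
        ≡⟨ solve 4 (λ u v c x → u :* v :* c := u :* ((x :+ v :* c) :- x)) refl (ℤ.1ℤ ℚ./ suc n) (fromℕ (suc n)) c (H (ℤ.+ 0)) ⟩
      ℤ.1ℤ ℚ./ suc n * (H (ℤ.+ 0) + fromℕ (suc n) * c - H (ℤ.+ 0))
        ≡⟨ cong (λ z → ℤ.1ℤ ℚ./ suc n * (z - H (ℤ.+ 0))) (trans (sym (linear (suc n))) period) ⟩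
      ℤ.1ℤ ℚ./ suc n * (H (ℤ.+ 0) - H (ℤ.+ 0))
        ≡⟨ solve 2 (λ u x → u :* (x :- x) := con 0ℚ) refl (ℤ.1ℤ ℚ./ suc n) (H (ℤ.+ 0)) ⟩
      0ℚ                                      ∎

    step′ : ∀ j → H (ℤ.suc j) ≡ H j
    step′ j = trans (step j) (trans (cong (H j +_) c≡0) (ℚ.+-identityʳ (H j)))

    constant : ∀ j → H j ≡ H (ℤ.+ 0)
    constant (ℤ.+ zero)   = refl
    constant (ℤ.+ suc i)  = trans (step′ (ℤ.+ i)) (constant (ℤ.+ i))
    constant -[1+ zero  ] = sym (step′ -[1+ 0 ])
    constant -[1+ suc i ] = trans (sym (step′ -[1+ suc i ])) (constant -[1+ i ])

-- The reflection formula for all integer exponents.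

module Reflection where

  open import Data.Integer.DivMod using (_%ℕ_; _/ℕ_; a≡a%ℕn+[a/ℕn]*n)
  open import Data.Rational.Base using (_+_; _*_; _-_; -_)
  open IntegerIdentities
  open PeriodicExtension
  open Polynomials
  open Congruence
  open ≡-Reasoning

  -- If F lists the coefficients of p, this says p = ε x⁻ᵏ p(1/x) up to a multiple of Ψ.
  Reflects : (ℤ → ℚ) → ℤ → ℚ → Set
  Reflects F k ε = ∃ λ c → ∀ j → F j ≡ ε * F (ℤ.- k ℤ.- j) + c

  module _ {F G : ℤ → ℚ} {b} (F≡ΔG : ∀ j → F (ℤ.suc j) ≡ G (ℤ.suc j) - G j + b) where

    -- Reflection reverses the direction of a difference, whence the new sign. The constant `c` of
    -- `G` cancels in the difference, and `b` enters once from each side of the formula.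
    reflects-pred : ∀ k ε → Reflects G (ℤ.suc k) ε → Reflects F k (- 1ℚ * ε)
    -- `F≡ΔG` speaks of `F` at successors only, so the formula is proved at `ℤ.suc j` and then
    -- transported along j = suc (pred j).
    reflects-pred k ε (c , G-refl) = b + ε * b , λ j → subst
      (λ j → F j ≡ - 1ℚ * ε * F (ℤ.- k ℤ.- j) + (b + ε * b)) (ℤ.suc-pred j) (at (ℤ.pred j))
      where
      at : ∀ j → F (ℤ.suc j) ≡ - 1ℚ * ε * F (ℤ.- k ℤ.- ℤ.suc j) + (b + ε * b)
      at j = begin
        F (ℤ.suc j)
          ≡⟨ F≡ΔG j ⟩
        G (ℤ.suc j) - G j + b
          ≡⟨ cong₂ (λ y z → y - z + b) (G-refl (ℤ.suc j)) (trans (G-refl j) (cong (λ i → ε * G i + c) (sym (reflect-suc k j)))) ⟩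
        (ε * G i + c) - (ε * G (ℤ.suc i) + c) + b
          ≡⟨ solve 5 (λ ε c b x y → ε :* x :+ c :- (ε :* y :+ c) :+ b := con (- 1ℚ) :* ε :* (y :- x :+ b) :+ (b :+ ε :* b)) refl ε c b (G i) (G (ℤ.suc i)) ⟩
        - 1ℚ * ε * (G (ℤ.suc i) - G i + b) + (b + ε * b)
          ≡⟨ cong (λ z → - 1ℚ * ε * z + (b + ε * b)) (trans (sym (F≡ΔG i)) (cong F (reflect-suc-index k j))) ⟩
        - 1ℚ * ε * F (ℤ.- k ℤ.- ℤ.suc j) + (b + ε * b) ∎
        where i = ℤ.- ℤ.suc k ℤ.- ℤ.suc j

    -- Here the difference operator has to be inverted: the reflection formula of `F` says that the
    -- defect `H` of the wanted formula for `G` has constant difference, and periodicity then makes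
    -- `H` itself constant.
    reflects-suc : ∀ n → (∀ j q → G (j ℤ.+ q ℤ.* ℤ.+ suc n) ≡ G j) →
      ∀ k ε → Reflects F k ε → Reflects G (ℤ.suc k) (- 1ℚ * ε)
    reflects-suc n G-periodic k ε (c , F-refl) = H (ℤ.+ 0) , λ j → begin
      G j
        ≡⟨ solve 3 (λ ε x y → x := con (- 1ℚ) :* ε :* y :+ (x :+ ε :* y)) refl ε (G j) (G (R j)) ⟩
      - 1ℚ * ε * G (R j) + H j
        ≡⟨ cong (- 1ℚ * ε * G (R j) +_) (constant-difference⇒constant n H (c - b + ε * b) step period j) ⟩
      - 1ℚ * ε * G (R j) + H (ℤ.+ 0) ∎
      where
      R : ℤ → ℤ
      R j = ℤ.- ℤ.suc k ℤ.- j
      H : ℤ → ℚ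
      H j = G j + ε * G (R j)

      step : ∀ j → H (ℤ.suc j) ≡ H j + (c - b + ε * b)
      step j = begin
        G (ℤ.suc j) + ε * G i
          ≡⟨ solve 6 (λ b ε x y u v → x :+ ε :* u := y :+ ε :* v :+ ((x :- y :+ b) :- b :- ε :* ((v :- u :+ b) :- b))) refl
               b ε (G (ℤ.suc j)) (G j) (G i) (G (ℤ.suc i)) ⟩
        G j + ε * G (ℤ.suc i) + (G (ℤ.suc j) - G j + b - b - ε * (G (ℤ.suc i) - G i + b - b))
          ≡⟨ cong₂ (λ y z → G j + ε * G (ℤ.suc i) + (y - b - ε * (z - b)))
               (trans (sym (F≡ΔG j)) (F-refl (ℤ.suc j)))
               (trans (sym (F≡ΔG i)) (cong F (reflect-suc-index k j))) ⟩
        G j + ε * G (ℤ.suc i) + (ε * F′ + c - b - ε * (F′ - b))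
          ≡⟨ cong (λ z → G j + ε * G z + (ε * F′ + c - b - ε * (F′ - b))) (reflect-suc k j) ⟩
        G j + ε * G (R j) + (ε * F′ + c - b - ε * (F′ - b))
          ≡⟨ solve 5 (λ h ε x c b → h :+ (ε :* x :+ c :- b :- ε :* (x :- b)) := h :+ (c :- b :+ ε :* b)) refl (H j) ε F′ c b ⟩
        H j + (c - b + ε * b) ∎
        where
        i  = R (ℤ.suc j)
        F′ = F (ℤ.- k ℤ.- ℤ.suc j)

      -- Moving `j` one period forward moves the reflected index one period back, hence the
      -- multipliers 1 and -1.
      period : H (ℤ.+ suc n) ≡ H (ℤ.+ 0)
      period = cong₂ (λ y z → y + ε * z)
        (trans (cong G (sym (trans (ℤ.+-identityˡ _) (ℤ.*-identityˡ (ℤ.+ suc n))))) (G-periodic (ℤ.+ 0) ℤ.1ℤ))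
        (trans (cong G (reflect-period (ℤ.suc k) (ℤ.+ suc n))) (G-periodic (R (ℤ.+ 0)) (ℤ.- ℤ.1ℤ)))

  -- This is (-1)ᵏ also for negative `k`. With the absolute value as exponent, each step away from
  -- 0, up or down, multiplies by -1 definitionally.
  sign : ℤ → ℚ
  sign k = (- 1ℚ) ^ ℤ.∣ k ∣

  module _ (n : ℕ) (g : ℤ → Poly) (g-degree : ∀ k → degree g k < suc n) (g-zero : g (ℤ.+ 0) ≈ 1ₚ)
    (g-recurrence : ∀ k → ∃ λ c → ∀ j →
      coeff (g k) j ≡ coeff (g (ℤ.suc k)) j - shift (g (ℤ.suc k)) j + c * coeff (Ψ (suc (suc n))) j) where

    private
      m = suc (suc n)
      F : ℤ → ℤ → ℚ
      F k = periodic m (g k)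

    -- The periodic extension of 1 is the indicator function of the multiples of `m`, and that
    -- function is even.
    reflects-zero : Reflects (F (ℤ.+ 0)) (ℤ.+ 0) 1ℚ
    reflects-zero = 0ℚ , λ j → begin
      F (ℤ.+ 0) j                         ≡⟨ g-zero (j %ℕ m) ⟩
      periodic m 1ₚ j                    ≡⟨ even j ⟩
      periodic m 1ₚ (ℤ.0ℤ ℤ.- j)         ≡⟨ g-zero ((ℤ.0ℤ ℤ.- j) %ℕ m) ⟨
      F (ℤ.+ 0) (ℤ.0ℤ ℤ.- j)                     ≡⟨ solve 1 (λ x → x := con 1ℚ :* x :+ con 0ℚ) refl (F (ℤ.+ 0) (ℤ.0ℤ ℤ.- j)) ⟩
      1ℚ * F (ℤ.+ 0) (ℤ.0ℤ ℤ.- j) + 0ℚ           ∎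
      where
      neg-residue : ∀ j → j %ℕ m ≡ 0 → (ℤ.0ℤ ℤ.- j) %ℕ m ≡ 0
      neg-residue j j%m≡0 = begin
        (ℤ.0ℤ ℤ.- j) %ℕ m
          ≡⟨ cong (λ i → (ℤ.0ℤ ℤ.- i) %ℕ m) (trans (a≡a%ℕn+[a/ℕn]*n j m) (cong (λ r → ℤ.+ r ℤ.+ q ℤ.* ℤ.+ m) j%m≡0)) ⟩
        (ℤ.0ℤ ℤ.- (ℤ.0ℤ ℤ.+ q ℤ.* ℤ.+ m)) %ℕ m
          ≡⟨ cong (_%ℕ m) (neg-multiple q (ℤ.+ m)) ⟩
        (ℤ.0ℤ ℤ.+ (ℤ.- q) ℤ.* ℤ.+ m) %ℕ m
          ≡⟨ %ℕ-unique m 0 (ℤ.- q) (s≤s z≤n) ⟩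
        0 ∎
        where q = j /ℕ m

      neg-involutive : ∀ j → ℤ.0ℤ ℤ.- (ℤ.0ℤ ℤ.- j) ≡ j
      neg-involutive = solve-∀

      even : ∀ j → periodic m 1ₚ j ≡ periodic m 1ₚ (ℤ.0ℤ ℤ.- j)
      even j with j %ℕ m in eq | (ℤ.0ℤ ℤ.- j) %ℕ m in eq′
      ... | zero  | zero  = refl
      ... | suc _ | suc _ = refl
      ... | zero  | suc _ with () ← trans (sym (neg-residue j eq)) eq′
      ... | suc _ | zero  with () ← trans (sym eq) (trans (cong (_%ℕ m) (sym (neg-involutive j))) (neg-residue (ℤ.0ℤ ℤ.- j) eq′))

    F-difference : ∀ k → ∃ λ b → ∀ j → F k (ℤ.suc j) ≡ F (ℤ.suc k) (ℤ.suc j) - F (ℤ.suc k) j + b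
    F-difference k with g-recurrence k
    ... | b , rel = b , periodic-difference (suc n) (g k) (g (ℤ.suc k)) b (g-degree (ℤ.suc k)) rel

    -- Induction from 0 in both directions. Downwards the known function is differenced; upwards the
    -- difference is inverted, which uses periodicity.
    reflects : ∀ k → Reflects (F k) k (sign k)
    reflects (ℤ.+ zero)   = reflects-zero
    reflects (ℤ.+ suc k)  = reflects-suc {F (ℤ.+ k)} {F (ℤ.+ suc k)} (proj₂ (F-difference (ℤ.+ k)))
                              (suc n) (periodic-+ m (g (ℤ.+ suc k))) (ℤ.+ k) (sign (ℤ.+ k)) (reflects (ℤ.+ k))
    reflects -[1+ zero  ] = reflects-pred {F -[1+ 0 ]} {F (ℤ.+ 0)} (proj₂ (F-difference -[1+ 0 ]))
                              -[1+ 0 ] 1ℚ (reflects (ℤ.+ 0))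
    reflects -[1+ suc k ] = reflects-pred {F -[1+ suc k ]} {F -[1+ k ]} (proj₂ (F-difference -[1+ suc k ]))
                              -[1+ suc k ] (sign -[1+ k ]) (reflects -[1+ k ])

    -- The constant left open by Reflects vanishes: at j = -1 both sides read the
    -- coefficient of xᵐ⁻¹, which is zero.
    symmetric : ∀ d i → i ℕ.< suc n → let k = ℤ.+ m ℤ.* d ℤ.+ ℤ.+ 2 in
      coeff (g k) i ≡ sign k * coeff (g k) (n ℕ.∸ i)
    symmetric d i i<n = begin
      coeff (g k) i
        ≡⟨ trans (cong (F k) (sym (ℤ.+-identityʳ (ℤ.+ i)))) (periodic-residue m (g k) {i} (ℤ.+ 0) (ℕ.m≤n⇒m≤1+n i<n)) ⟨
      F k (ℤ.+ i)
        ≡⟨ F-refl (ℤ.+ i) ⟩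
      sign k * F k (ℤ.- k ℤ.- ℤ.+ i) + c
        ≡⟨ cong₂ (λ y z → sign k * y + z)
             (trans (cong (F k) index) (periodic-residue m (g k) (ℤ.- d ℤ.- ℤ.1ℤ) (s≤s (ℕ.m≤n⇒m≤1+n (ℕ.m∸n≤m n i))))) c≡0 ⟩
      sign k * coeff (g k) e + 0ℚ
        ≡⟨ ℚ.+-identityʳ _ ⟩
      sign k * coeff (g k) e ∎
      where
      k = ℤ.+ m ℤ.* d ℤ.+ ℤ.+ 2
      e = n ℕ.∸ i
      c = proj₁ (reflects k)
      F-refl = proj₂ (reflects k)

      index : ℤ.- k ℤ.- ℤ.+ i ≡ ℤ.+ e ℤ.+ (ℤ.- d ℤ.- ℤ.1ℤ) ℤ.* ℤ.+ m
      index = subst (λ n → ℤ.- (ℤ.+ suc n ℤ.* d ℤ.+ ℤ.+ 2) ℤ.- ℤ.+ i ≡ ℤ.+ e ℤ.+ (ℤ.- d ℤ.- ℤ.1ℤ) ℤ.* ℤ.+ suc n)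
        (ℕ.m+[n∸m]≡n i<n) (reflect-residue (ℤ.+ i) (ℤ.+ e) d)

      top : ∀ q → F k (ℤ.+ suc n ℤ.+ q ℤ.* ℤ.+ m) ≡ 0ℚ
      top q = trans (periodic-residue m (g k) q (ℕ.n<1+n (suc n))) (g-degree k (suc n) ℕ.≤-refl)

      c≡0 : c ≡ 0ℚ
      c≡0 = begin
        c
          ≡⟨ solve 2 (λ c s → c := s :* con 0ℚ :+ c) refl c (sign k) ⟩
        sign k * 0ℚ + c
          ≡⟨ cong (λ z → sign k * z + c) (trans (cong (F k) (reflect-last (ℤ.+ suc n) d)) (top (ℤ.- d ℤ.- ℤ.1ℤ))) ⟨
        sign k * F k (ℤ.- k ℤ.- -[1+ 0 ]) + c
          ≡⟨ F-refl -[1+ 0 ] ⟨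
        F k -[1+ 0 ]
          ≡⟨ trans (cong (F k) (last-residue (ℤ.+ suc n))) (top (ℤ.- ℤ.1ℤ)) ⟩
        0ℚ ∎

  f-recurrence : ∀ n k → ∃ λ c → ∀ j →
    coeff (f (suc n) k) j ≡ coeff (f (suc n) (ℤ.suc k)) j - shift (f (suc n) (ℤ.suc k)) j + c * coeff (Ψ (suc n)) j
  f-recurrence n k = mod-degree≤ n {f (suc n) k} {f (suc n) (ℤ.suc k)}
    (λ j n<j → f-degree (suc n) k j (ℕ.≤-trans (ℕ.n≤1+n n) n<j)) (f-degree (suc n) (ℤ.suc k))
    (Setoid.trans (modSetoid (Ψ (suc n))) {f (suc n) k} {[1-x]^ (suc n) (ℤ.- k)} {1-x ⊗ f (suc n) (ℤ.suc k)}
      (f-mod (suc n) k) (f-mod-suc (suc n) k))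

  -- From m = 2 on, the constant 1 has degree below m - 1 and is its own remainder. For m = 1 the
  -- remainder is the zero polynomial, hence the two successors.
  f-zero : ∀ n → f (suc (suc n)) (ℤ.+ 0) ≈ 1ₚ
  f-zero n = remainder-unique (suc n) {1ₚ} {f (suc (suc n)) (ℤ.+ 0)} {1ₚ}
    (f-degree (suc (suc n)) (ℤ.+ 0)) (f-mod (suc (suc n)) (ℤ.+ 0))
    (λ { zero () ; (suc j) _ → refl }) (≈⇒mod {1ₚ} {1ₚ} (Ψ (suc (suc n))) λ _ → refl)

  -- For m = 1 there is no index `i` below 0, which leaves m ≥ 2, where `f-zero` applies.
  f-symmetric : ∀ n d i → i ℕ.< n → let k = ℤ.+ suc n ℤ.* d ℤ.+ ℤ.+ 2 in
    coeff (f (suc n) k) i ≡ sign k * coeff (f (suc n) k) (n ℕ.∸ suc i)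
  f-symmetric (suc n) = symmetric n (f (suc (suc n))) (f-degree (suc (suc n))) (f-zero n) (f-recurrence (suc n))

-- Taylor expansion at 1 and generalised binomial coefficients.

module Taylor where

  open import Data.Rational.Base using (_+_; _*_; _-_; -_)
  open ≡-Reasoning

  -- The coefficients of p(1 + u) as a polynomial in u.
  taylor : Poly → Series
  taylor []      n       = 0ℚ
  taylor (a ∷ p) zero    = a + taylor p zero
  taylor (a ∷ p) (suc n) = taylor p (suc n) + taylor p n

  taylor-⊕ : ∀ p q n → taylor (p ⊕ q) n ≡ taylor p n + taylor q n
  taylor-⊕ []      q       n       = sym (ℚ.+-identityˡ _)
  taylor-⊕ (a ∷ p) []      n       = sym (ℚ.+-identityʳ _)
  taylor-⊕ (a ∷ p) (b ∷ q) zero    = begin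
    a + b + taylor (p ⊕ q) 0                  ≡⟨ cong (a + b +_) (taylor-⊕ p q 0) ⟩
    a + b + (taylor p 0 + taylor q 0)         ≡⟨ solve 4 (λ a b x y → a :+ b :+ (x :+ y) := a :+ x :+ (b :+ y)) refl a b (taylor p 0) (taylor q 0) ⟩
    a + taylor p 0 + (b + taylor q 0)         ∎
  taylor-⊕ (a ∷ p) (b ∷ q) (suc n) = begin
    taylor (p ⊕ q) (suc n) + taylor (p ⊕ q) n
      ≡⟨ cong₂ _+_ (taylor-⊕ p q (suc n)) (taylor-⊕ p q n) ⟩
    taylor p (suc n) + taylor q (suc n) + (taylor p n + taylor q n)
      ≡⟨ solve 4 (λ a b x y → a :+ b :+ (x :+ y) := a :+ x :+ (b :+ y)) refl (taylor p (suc n)) (taylor q (suc n)) (taylor p n) (taylor q n) ⟩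
    taylor p (suc n) + taylor p n + (taylor q (suc n) + taylor q n) ∎

  taylor-· : ∀ c p n → taylor (c · p) n ≡ c * taylor p n
  taylor-· c []      n       = sym (ℚ.*-zeroʳ c)
  taylor-· c (a ∷ p) zero    = trans (cong (c * a +_) (taylor-· c p 0)) (sym (ℚ.*-distribˡ-+ c a (taylor p 0)))
  taylor-· c (a ∷ p) (suc n) = trans (cong₂ _+_ (taylor-· c p (suc n)) (taylor-· c p n))
                                 (sym (ℚ.*-distribˡ-+ c (taylor p (suc n)) (taylor p n)))

  taylor-zero : ∀ p → p ≈ [] → ∀ n → taylor p n ≡ 0ℚ
  taylor-zero []      p≈0 n       = refl
  taylor-zero (a ∷ p) p≈0 zero    = cong₂ _+_ (p≈0 0) (taylor-zero p (p≈0 ∘ suc) 0)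
  taylor-zero (a ∷ p) p≈0 (suc n) = cong₂ _+_ (taylor-zero p (p≈0 ∘ suc) (suc n)) (taylor-zero p (p≈0 ∘ suc) n)

  taylor-cong : ∀ p q → p ≈ q → ∀ n → taylor p n ≡ taylor q n
  taylor-cong []      q       p≈q n       = sym (taylor-zero q (sym ∘ p≈q) n)
  taylor-cong (a ∷ p) []      p≈q n       = taylor-zero (a ∷ p) p≈q n
  taylor-cong (a ∷ p) (b ∷ q) p≈q zero    = cong₂ _+_ (p≈q 0) (taylor-cong p q (p≈q ∘ suc) 0)
  taylor-cong (a ∷ p) (b ∷ q) p≈q (suc n) =
    cong₂ _+_ (taylor-cong p q (p≈q ∘ suc) (suc n)) (taylor-cong p q (p≈q ∘ suc) n)

  -- With x = 1 + u the factor 1 - x is -u: it kills the constant term, and by `taylor-[1-x]-suc` it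
  -- shifts the others with a change of sign.
  taylor-[1-x]-zero : ∀ q → taylor (1-x ⊗ q) 0 ≡ 0ℚ
  taylor-[1-x]-zero q = begin
    taylor (1ℚ · q ⊕ (0ℚ ∷ (- 1ℚ) · q ⊕ (0ℚ ∷ []))) 0
      ≡⟨ taylor-⊕ (1ℚ · q) _ 0 ⟩
    taylor (1ℚ · q) 0 + (0ℚ + taylor ((- 1ℚ) · q ⊕ (0ℚ ∷ [])) 0)
      ≡⟨ cong₂ (λ y z → y + (0ℚ + z)) (taylor-· 1ℚ q 0)
           (trans (taylor-⊕ ((- 1ℚ) · q) _ 0) (cong (_+ (0ℚ + 0ℚ)) (taylor-· (- 1ℚ) q 0))) ⟩
    1ℚ * taylor q 0 + (0ℚ + (- 1ℚ * taylor q 0 + (0ℚ + 0ℚ)))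
      ≡⟨ solve 1 (λ x → con 1ℚ :* x :+ (con 0ℚ :+ (con (- 1ℚ) :* x :+ (con 0ℚ :+ con 0ℚ))) := con 0ℚ) refl (taylor q 0) ⟩
    0ℚ ∎

  taylor-[1-x]-suc : ∀ q n → taylor (1-x ⊗ q) (suc n) ≡ - taylor q n
  taylor-[1-x]-suc q n = begin
    taylor (1ℚ · q ⊕ (0ℚ ∷ (- 1ℚ) · q ⊕ (0ℚ ∷ []))) (suc n)
      ≡⟨ taylor-⊕ (1ℚ · q) _ (suc n) ⟩
    taylor (1ℚ · q) (suc n) + (taylor ((- 1ℚ) · q ⊕ (0ℚ ∷ [])) (suc n) + taylor ((- 1ℚ) · q ⊕ (0ℚ ∷ [])) n)
      ≡⟨ cong₂ _+_ (taylor-· 1ℚ q (suc n)) (cong₂ _+_ (tail (suc n)) (tail n)) ⟩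
    1ℚ * taylor q (suc n) + (- 1ℚ * taylor q (suc n) + - 1ℚ * taylor q n)
      ≡⟨ solve 2 (λ x y → con 1ℚ :* x :+ (con (- 1ℚ) :* x :+ con (- 1ℚ) :* y) := :- y) refl (taylor q (suc n)) (taylor q n) ⟩
    - taylor q n ∎
    where
    tail : ∀ n → taylor ((- 1ℚ) · q ⊕ (0ℚ ∷ [])) n ≡ - 1ℚ * taylor q n
    tail n = trans (taylor-⊕ ((- 1ℚ) · q) _ n)
      (trans (cong₂ _+_ (taylor-· (- 1ℚ) q n) (taylor-zero (0ℚ ∷ []) coeff-0∷[] n)) (ℚ.+-identityʳ _))

  -- Pascal's rule for a rational upper argument, proved from the product recursion by induction on
  -- the lower one.
  binomial-pascal : ∀ a n → binomial (1ℚ + a) (suc n) ≡ binomial a (suc n) + binomial a n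
  binomial-pascal a zero    = solve 1 (λ a → con 1ℚ :* (con 1ℚ :+ a :- con 0ℚ) :* con 1ℚ := con 1ℚ :* (a :- con 0ℚ) :* con 1ℚ :+ con 1ℚ) refl a
  binomial-pascal a (suc n) = begin
    binomial (1ℚ + a) (suc n) * (1ℚ + a - fromℕ (suc n)) * r
      ≡⟨ cong₂ (λ y z → y * (1ℚ + a - z) * r) (binomial-pascal a n) (fromℕ-suc n) ⟩
    (B * (a - fromℕ n) * s + B) * (1ℚ + a - (1ℚ + fromℕ n)) * r
      ≡⟨ solve 5 (λ B s a n r → (B :* (a :- n) :* s :+ B) :* (con 1ℚ :+ a :- (con 1ℚ :+ n)) :* r
           := B :* (a :- n) :* s :* (a :- n) :* r :+ B :* (a :- n) :* r :* con 1ℚ) refl B s a (fromℕ n) r ⟩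
    B′ * (a - fromℕ n) * r + B * (a - fromℕ n) * r * 1ℚ
      -- Writing 1 as `s` (n + 1) turns the second summand into a multiple of `B′`. Then (a - n) +
      -- (n + 1) is regrouped as (a - (n + 1)) + (n + 2), and `r` (n + 2) = 1.
      ≡⟨ cong (λ z → B′ * (a - fromℕ n) * r + B * (a - fromℕ n) * r * z) unit ⟨
    B′ * (a - fromℕ n) * r + B * (a - fromℕ n) * r * (s * (1ℚ + fromℕ n))
      ≡⟨ solve 5 (λ B s a n r →
           B :* (a :- n) :* s :* (a :- n) :* r :+ B :* (a :- n) :* r :* (s :* (con 1ℚ :+ n))
           := B :* (a :- n) :* s :* (a :- (con 1ℚ :+ n)) :* r
              :+ B :* (a :- n) :* s :* (r :* (con 1ℚ :+ (con 1ℚ :+ n)))) refl B s a (fromℕ n) r ⟩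
    B′ * (a - (1ℚ + fromℕ n)) * r + B′ * (r * (1ℚ + (1ℚ + fromℕ n)))
      ≡⟨ cong₂ (λ y z → B′ * (a - y) * r + B′ * z) (sym (fromℕ-suc n)) unit′ ⟩
    B′ * (a - fromℕ (suc n)) * r + B′ * 1ℚ
      ≡⟨ cong (B′ * (a - fromℕ (suc n)) * r +_) (ℚ.*-identityʳ B′) ⟩
    B′ * (a - fromℕ (suc n)) * r + B′ ∎
    where
    B  = binomial a n
    B′ = binomial a (suc n)
    s  = ℤ.1ℤ ℚ./ suc n
    r  = ℤ.1ℤ ℚ./ suc (suc n)
    unit : s * (1ℚ + fromℕ n) ≡ 1ℚ
    unit = trans (cong (s *_) (sym (fromℕ-suc n))) (1/n*n≡1 (suc n))
    unit′ : r * (1ℚ + (1ℚ + fromℕ n)) ≡ 1ℚ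
    unit′ = trans (cong (λ z → r * (1ℚ + z)) (sym (fromℕ-suc n)))
              (trans (cong (r *_) (sym (fromℕ-suc (suc n)))) (1/n*n≡1 (suc (suc n))))

  binomial-zero : ∀ n → binomial 0ℚ (suc n) ≡ 0ℚ
  binomial-zero zero    = refl
  binomial-zero (suc n) = trans (cong (λ z → z * (0ℚ - fromℕ (suc n)) * r) (binomial-zero n))
    (solve 2 (λ x r → con 0ℚ :* x :* r := con 0ℚ) refl (0ℚ - fromℕ (suc n)) r)
    where r = ℤ.1ℤ ℚ./ suc (suc n)

  -- Ψ(1 + u) = ((1 + u)ᵐ - 1) / u
  taylor-Ψ : ∀ m n → taylor (Ψ m) n ≡ binomial (fromℕ m) (suc n)
  taylor-Ψ zero    n       = sym (binomial-zero n)
  taylor-Ψ (suc m) n       = trans (step n) (trans (sym (binomial-pascal (fromℕ m) n))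
                               (cong (λ a → binomial a (suc n)) (sym (fromℕ-suc m))))
    where
    step : ∀ n → taylor (1ℚ ∷ Ψ m) n ≡ binomial (fromℕ m) (suc n) + binomial (fromℕ m) n
    step zero    = trans (ℚ.+-comm 1ℚ (taylor (Ψ m) 0)) (cong (_+ 1ℚ) (taylor-Ψ m 0))
    step (suc n) = cong₂ _+_ (taylor-Ψ m (suc n)) (taylor-Ψ m n)

-- Degenerate Bernoulli numbers by long division of power series.

module DegenerateBernoulli where

  open import Data.Rational.Base using (_+_; _*_; _-_; -_)
  open Polynomials
  open Congruence
  open Taylor
  open ≡-Reasoning

  -- Division of power series with the variable rescaled by l: the n-th state of
  -- the division algorithm is a lⁿ times the series G n.
  ÷ₛ-unfold : ∀ l (c C : Series) → (∀ j → c (suc j) ≡ C (suc j) * l ^ suc j) →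
    ∀ n a (r : Series) (G : ℕ → Series) →
    (∀ j → r j ≡ a * l ^ j * G 0 j) →
    (∀ k j → G (suc k) j ≡ G k (suc j) - G k 0 * C (suc j)) →
    (r ÷ₛ c) n ≡ a * l ^ n * G n 0
  ÷ₛ-unfold l c C c≡ zero    a r G r≡ G-step = r≡ 0
  ÷ₛ-unfold l c C c≡ (suc n) a r G r≡ G-step = begin
    ((λ j → r (suc j) - r 0 * c (suc j)) ÷ₛ c) n
      ≡⟨ ÷ₛ-unfold l c C c≡ n (a * l) _ (G ∘ suc) step (λ k j → G-step (suc k) j) ⟩
    a * l * l ^ n * G (suc n) 0
      ≡⟨ cong (_* G (suc n) 0) (ℚ.*-assoc a l (l ^ n)) ⟩
    a * (l * l ^ n) * G (suc n) 0 ∎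
    where
    step : ∀ j → r (suc j) - r 0 * c (suc j) ≡ a * l * l ^ j * G 1 j
    step j = begin
      r (suc j) - r 0 * c (suc j)
        ≡⟨ cong₂ _-_ (r≡ (suc j)) (cong₂ _*_ (r≡ 0) (c≡ j)) ⟩
      a * (l * l ^ j) * G 0 (suc j) - a * 1ℚ * G 0 0 * (C (suc j) * (l * l ^ j))
        ≡⟨ solve 6 (λ a l x g h C → a :* (l :* x) :* g :- a :* con 1ℚ :* h :* (C :* (l :* x)) := a :* l :* x :* (g :- h :* C)) refl
             a l (l ^ j) (G 0 (suc j)) (G 0 0) (C (suc j)) ⟩
      a * l * l ^ j * (G 0 (suc j) - G 0 0 * C (suc j))
        ≡⟨ cong (a * l * l ^ j *_) (G-step 0 j) ⟨
      a * l * l ^ j * G 1 j ∎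

  binomial₁ : ∀ a → binomial a 1 ≡ a
  binomial₁ = solve 1 (λ a → con 1ℚ :* (a :- con 0ℚ) :* con 1ℚ := a) refl

  -- The recurrence for `g` performs the long division of 1 by Ψ(1 + u)/m, so the k-th coefficient
  -- of the quotient is a multiple of the value of `g k` at 1.
  β-vanishes : ∀ n (g : ℕ → Poly) → g 0 ≈ 1ₚ →
    (∀ k → ∃ λ c → g k ≈ 1-x ⊗ g (suc k) ⊕ c · Ψ (suc n)) →
    ∀ k .{{_ : ℚ.NonZero (ℤ.1ℤ ℚ./ suc n)}} → taylor (g k) 0 ≡ 0ℚ → β k (ℤ.1ℤ ℚ./ suc n) ≡ 0ℚ
  β-vanishes n g g-zero g-recurrence k g[1]≡0 = begin
    (1ₛ ÷ₛ (denominator l ∘ suc)) k * fromℕ (k !)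
      ≡⟨ cong (_* fromℕ (k !)) (÷ₛ-unfold l (denominator l ∘ suc) C denominator≡ k 1ℚ 1ₛ G start G-step) ⟩
    1ℚ * l ^ k * ((- 1ℚ) ^ k * taylor (g k) 0) * fromℕ (k !)
      ≡⟨ cong (λ z → 1ℚ * l ^ k * ((- 1ℚ) ^ k * z) * fromℕ (k !)) g[1]≡0 ⟩
    1ℚ * l ^ k * ((- 1ℚ) ^ k * 0ℚ) * fromℕ (k !)
      ≡⟨ solve 3 (λ x y z → con 1ℚ :* x :* (y :* con 0ℚ) :* z := con 0ℚ) refl (l ^ k) ((- 1ℚ) ^ k) (fromℕ (k !)) ⟩
    0ℚ ∎
    where
    m = suc n
    l = ℤ.1ℤ ℚ./ m
    -- This is Ψ(1 + u)/m, with constant term 1 because Ψ(1) = m. Under u = `l` t it becomes the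
    -- denominator divided by t.
    C : Series
    C j = taylor (Ψ m) j * l
    -- The k-th state of the division; the sign arises because each step divides by u = -(1 - x).
    G : ℕ → Series
    G k j = (- 1ℚ) ^ k * taylor (g k) j

    1/l≡m : ℚ.1/ l ≡ fromℕ m
    1/l≡m = begin
      ℚ.1/ l                        ≡⟨ ℚ.*-identityʳ _ ⟨
      ℚ.1/ l * 1ℚ                   ≡⟨ cong (ℚ.1/ l *_) (1/n*n≡1 m) ⟨
      ℚ.1/ l * (l * fromℕ m)        ≡⟨ ℚ.*-assoc (ℚ.1/ l) l (fromℕ m) ⟨
      ℚ.1/ l * l * fromℕ m          ≡⟨ cong (_* fromℕ m) (ℚ.*-inverseˡ l) ⟩
      1ℚ * fromℕ m                  ≡⟨ ℚ.*-identityˡ _ ⟩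
      fromℕ m                       ∎

    denominator≡ : ∀ j → denominator l (suc (suc j)) ≡ C (suc j) * l ^ suc j
    denominator≡ j = begin
      binomial (ℚ.1/ l) (suc (suc j)) * (l * l ^ suc j) - 0ℚ
        ≡⟨ cong (λ z → z * (l * l ^ suc j) - 0ℚ) (trans (cong (λ a → binomial a (suc (suc j))) 1/l≡m) (sym (taylor-Ψ m (suc j)))) ⟩
      taylor (Ψ m) (suc j) * (l * l ^ suc j) - 0ℚ
        ≡⟨ solve 3 (λ x l y → x :* (l :* y) :- con 0ℚ := x :* l :* y) refl (taylor (Ψ m) (suc j)) l (l ^ suc j) ⟩
      taylor (Ψ m) (suc j) * l * l ^ suc j ∎

    start : ∀ j → 1ₛ j ≡ 1ℚ * l ^ j * G 0 j
    start zero    = sym (cong (λ z → 1ℚ * 1ℚ * (1ℚ * z)) (taylor-cong (g 0) 1ₚ g-zero 0))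
    start (suc j) = sym (trans (cong (λ z → 1ℚ * l ^ suc j * (1ℚ * z)) (taylor-cong (g 0) 1ₚ g-zero (suc j)))
      (solve 1 (λ x → con 1ℚ :* x :* (con 1ℚ :* con 0ℚ) := con 0ℚ) refl (l ^ suc j)))

    G-step : ∀ k j → G (suc k) j ≡ G k (suc j) - G k 0 * C (suc j)
    G-step k j = sym (begin
      s * taylor (g k) (suc j) - s * taylor (g k) 0 * (ψ * l)
        ≡⟨ cong₂ (λ y z → s * y - s * z * (ψ * l)) tail head ⟩
      s * (- t + c * ψ) - s * (c * fromℕ m) * (ψ * l)
        ≡⟨ solve 6 (λ s t c p l m → s :* (:- t :+ c :* p) :- s :* (c :* m) :* (p :* l)
             := con (- 1ℚ) :* s :* t :+ s :* c :* p :* (con 1ℚ :- l :* m)) refl s t c ψ l (fromℕ m) ⟩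
      - 1ℚ * s * t + s * c * ψ * (1ℚ - l * fromℕ m)
        ≡⟨ cong (λ z → - 1ℚ * s * t + s * c * ψ * (1ℚ - z)) (1/n*n≡1 m) ⟩
      - 1ℚ * s * t + s * c * ψ * (1ℚ - 1ℚ)
        ≡⟨ solve 2 (λ x y → x :+ y :* (con 1ℚ :- con 1ℚ) := x) refl (- 1ℚ * s * t) (s * c * ψ) ⟩
      - 1ℚ * s * t ∎)
      where
      c = proj₁ (g-recurrence k)
      s = (- 1ℚ) ^ k
      ψ = taylor (Ψ m) (suc j)
      t = taylor (g (suc k)) j

      expand : ∀ i → taylor (g k) i ≡ taylor (1-x ⊗ g (suc k)) i + c * taylor (Ψ m) i
      expand i = trans (taylor-cong (g k) (1-x ⊗ g (suc k) ⊕ c · Ψ m) (proj₂ (g-recurrence k)) i)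
        (trans (taylor-⊕ (1-x ⊗ g (suc k)) _ i) (cong (taylor (1-x ⊗ g (suc k)) i +_) (taylor-· c (Ψ m) i)))

      tail : taylor (g k) (suc j) ≡ - t + c * ψ
      tail = trans (expand (suc j)) (cong (_+ c * ψ) (taylor-[1-x]-suc (g (suc k)) j))

      -- At x = 1 the term with the factor 1 - x drops out and Ψ(1) = m. So the multiple of Ψ in the
      -- recurrence is exactly the one that a division step subtracts.
      head : taylor (g k) 0 ≡ c * fromℕ m
      head = trans (expand 0) (trans (cong₂ (λ y z → y + c * z) (taylor-[1-x]-zero (g (suc k)))
        (trans (taylor-Ψ m 0) (binomial₁ (fromℕ m)))) (ℚ.+-identityˡ _))

  -- The powers (1 - x)⁻ᵏ, except that the first is 1 also when m = 1.
  f′ : (m : ℕ) .{{_ : ℕ.NonZero m}} → ℕ → Poly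
  f′ m zero    = 1ₚ
  f′ m (suc k) = f m (ℤ.+ suc k)

  f′-recurrence : ∀ n k → ∃ λ c → f′ (suc n) k ≈ 1-x ⊗ f′ (suc n) (suc k) ⊕ c · Ψ (suc n)
  f′-recurrence n k = proj₁ rel , λ j → begin
    coeff (f′ m k) j
      ≡⟨ proj₂ rel j ⟩
    coeff (f m (ℤ.+ suc k)) j - shift (f m (ℤ.+ suc k)) j + proj₁ rel * coeff (Ψ m) j
      ≡⟨ cong₂ _+_ (coeff-[1-x]⊗ (f m (ℤ.+ suc k)) j) (coeff-· (proj₁ rel) (Ψ m) j) ⟨
    coeff (1-x ⊗ f m (ℤ.+ suc k)) j + coeff (proj₁ rel · Ψ m) j
      ≡⟨ coeff-⊕ (1-x ⊗ f m (ℤ.+ suc k)) _ j ⟨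
    coeff (1-x ⊗ f m (ℤ.+ suc k) ⊕ proj₁ rel · Ψ m) j ∎
    where
    m = suc n
    -- The weaker bound, one above that of `f-degree`, holds for the constant 1 even when m = 1.
    degree′ : ∀ k → degree f′ m k < suc n
    degree′ zero    (suc j) _   = refl
    degree′ (suc k) j       n<j = f-degree m (ℤ.+ suc k) j (ℕ.≤-trans (ℕ.n≤1+n n) n<j)
    mod′ : ∀ k → f′ m k ≡ [1-x]^ m (ℤ.- ℤ.+ k) [mod Ψ m ]
    mod′ zero    = Setoid.refl (modSetoid (Ψ m)) {1ₚ}
    mod′ (suc k) = f-mod m (ℤ.+ suc k)
    rel = mod-degree≤ n {f′ m k} {f m (ℤ.+ suc k)} (degree′ k) (f-degree m (ℤ.+ suc k))
      (Setoid.trans (modSetoid (Ψ m)) {f′ m k} {[1-x]^ m (ℤ.- ℤ.+ k)} {1-x ⊗ f m (ℤ.+ suc k)}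
        (mod′ k) (f-mod-suc m (ℤ.+ k)))

  β-taylor : ∀ n k .{{_ : ℚ.NonZero (ℤ.1ℤ ℚ./ suc n)}} →
    taylor (f′ (suc n) k) 0 ≡ 0ℚ → β k (ℤ.1ℤ ℚ./ suc n) ≡ 0ℚ
  β-taylor n = β-vanishes n (f′ (suc n)) (λ _ → refl) (f′-recurrence n)

-- Symmetric coefficient sequences and the value at 1.

module Symmetry where

  open import Algebra.Properties.CommutativeMonoid.Sum ℚ.+-0-commutativeMonoid using (sum; sum-permute; sum-cong-≗)
  open import Data.Fin.Base using (Fin; zero; suc; toℕ; opposite)
  import Data.Fin.Permutation as Permutation
  open import Data.Fin.Properties using (toℕ<n; opposite-prop)
  open import Data.Rational.Base using (_+_; _*_; -_)
  open Taylor
  open ≡-Reasoning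

  sum-zero : ∀ n (a : Fin n → ℚ) → (∀ i → a i ≡ 0ℚ) → sum a ≡ 0ℚ
  sum-zero zero    a a≡0 = refl
  sum-zero (suc n) a a≡0 = cong₂ _+_ (a≡0 zero) (sum-zero n (a ∘ suc) (a≡0 ∘ suc))

  -- The value at 1 is rewritten as a sum over `Fin n`, independent of the length of the list `p`,
  -- so that the reversal of indices can act on it as a permutation.
  taylor-sum : ∀ n p → degree p < n → taylor p 0 ≡ sum {n} (coeff p ∘ toℕ)
  taylor-sum n       []      deg = sym (sum-zero n _ λ _ → refl)
  taylor-sum zero    (a ∷ p) deg = taylor-zero (a ∷ p) (λ j → deg j z≤n) 0
  taylor-sum (suc n) (a ∷ p) deg = cong (a +_) (taylor-sum n p (λ j n≤j → deg (suc j) (s≤s n≤j)))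

  sum-neg : ∀ n (a : Fin n → ℚ) → sum (λ i → - a i) ≡ - sum a
  sum-neg zero    a = refl
  sum-neg (suc n) a = trans (cong (- a zero +_) (sum-neg n (a ∘ suc))) (sym (ℚ.neg-distrib-+ (a zero) _))

  x≡-x⇒x≡0 : ∀ x → x ≡ - x → x ≡ 0ℚ
  x≡-x⇒x≡0 x eq = begin
    x                    ≡⟨ solve 1 (λ x → x := con ℚ.½ :* (x :+ x)) refl x ⟩
    ℚ.½ * (x + x)        ≡⟨ cong (λ z → ℚ.½ * (x + z)) eq ⟩
    ℚ.½ * (x + - x)      ≡⟨ solve 1 (λ x → con ℚ.½ :* (x :+ :- x) := con 0ℚ) refl x ⟩
    0ℚ                   ∎

  neg-one-* : ∀ x → - 1ℚ * x ≡ - x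
  neg-one-* = solve 1 (λ x → con (- 1ℚ) :* x := :- x) refl

  -- Reversing the order of summation leaves the sum of the coefficients unchanged, while
  -- antisymmetry negates it.
  antisymmetric⇒root : ∀ n p s → s ≡ - 1ℚ → degree p < n →
    (∀ i → i ℕ.< n → coeff p i ≡ s * coeff p (n ℕ.∸ suc i)) → taylor p 0 ≡ 0ℚ
  antisymmetric⇒root n p s s≡-1 deg anti = trans (taylor-sum n p deg) (x≡-x⇒x≡0 S (begin
    S                                             ≡⟨ sum-cong-≗ reflected ⟩
    sum {n} (λ i → - coeff p (toℕ (opposite i)))  ≡⟨ sum-neg n _ ⟩
    - sum {n} (coeff p ∘ toℕ ∘ opposite)          ≡⟨ cong -_ (sum-permute {n} (coeff p ∘ toℕ) Permutation.reverse) ⟨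
    - S                                           ∎))
    where
    S = sum {n} (coeff p ∘ toℕ)
    reflected : ∀ (i : Fin n) → coeff p (toℕ i) ≡ - coeff p (toℕ (opposite i))
    reflected i = begin
      coeff p (toℕ i)                        ≡⟨ anti (toℕ i) (toℕ<n i) ⟩
      s * coeff p (n ℕ.∸ suc (toℕ i))        ≡⟨ cong₂ (λ s j → s * coeff p j) s≡-1 (sym (opposite-prop i)) ⟩
      - 1ℚ * coeff p (toℕ (opposite i))      ≡⟨ neg-one-* (coeff p (toℕ (opposite i))) ⟩
      - coeff p (toℕ (opposite i))           ∎

  -- The darga is m - 2 = n - 1. Outside the range 0 ≤ j < n both coefficients vanish, because the
  -- reflection exchanges the negative indices with those from n on.
  symmetric-coeffℤ : ∀ n p s → degree p < n → (∀ i → i ℕ.< n → coeff p i ≡ s * coeff p (n ℕ.∸ suc i)) →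
    ∀ j → coeffℤ p j ≡ s * coeffℤ p (ℤ.+ suc n ℤ.- ℤ.+ 2 ℤ.- j)
  symmetric-coeffℤ n p s deg sym-p (ℤ.+ i) with i ℕ.<? n
  ... | yes i<n = trans (sym-p i i<n) (cong (λ j → s * coeffℤ p j) (sym index))
    where
    reindex : ∀ i e → ℤ.1ℤ ℤ.+ (ℤ.1ℤ ℤ.+ i ℤ.+ e) ℤ.- (ℤ.1ℤ ℤ.+ ℤ.1ℤ) ℤ.- i ≡ e
    reindex = solve-∀
    index : ℤ.+ suc n ℤ.- ℤ.+ 2 ℤ.- ℤ.+ i ≡ ℤ.+ (n ℕ.∸ suc i)
    index = subst (λ n′ → ℤ.+ suc n′ ℤ.- ℤ.+ 2 ℤ.- ℤ.+ i ≡ ℤ.+ (n ℕ.∸ suc i))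
      (ℕ.m+[n∸m]≡n i<n) (reindex (ℤ.+ i) (ℤ.+ (n ℕ.∸ suc i)))
  ... | no i≮n = trans (deg i n≤i) (sym (trans (cong (λ j → s * coeffℤ p j) index) (ℚ.*-zeroʳ s)))
    where
    n≤i = ℕ.≮⇒≥ i≮n
    reindex : ∀ n e → ℤ.1ℤ ℤ.+ n ℤ.- (ℤ.1ℤ ℤ.+ ℤ.1ℤ) ℤ.- (n ℤ.+ e) ≡ ℤ.- (ℤ.1ℤ ℤ.+ e)
    reindex = solve-∀
    index : ℤ.+ suc n ℤ.- ℤ.+ 2 ℤ.- ℤ.+ i ≡ -[1+ i ℕ.∸ n ]
    index = subst (λ i′ → ℤ.+ suc n ℤ.- ℤ.+ 2 ℤ.- ℤ.+ i′ ≡ -[1+ i ℕ.∸ n ])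
      (ℕ.m+[n∸m]≡n n≤i) (reindex (ℤ.+ n) (ℤ.+ (i ℕ.∸ n)))
  symmetric-coeffℤ n p s deg sym-p -[1+ i ] = sym (trans (cong (λ j → s * coeffℤ p j) (reindex (ℤ.+ n) (ℤ.+ i)))
    (trans (cong (s *_) (deg (n ℕ.+ i) (ℕ.m≤m+n n i))) (ℚ.*-zeroʳ s)))
    where
    reindex : ∀ n i → ℤ.1ℤ ℤ.+ n ℤ.- (ℤ.1ℤ ℤ.+ ℤ.1ℤ) ℤ.- (ℤ.- (ℤ.1ℤ ℤ.+ i)) ≡ n ℤ.+ i
    reindex = solve-∀

  symmetric⇒𝒫 : ∀ n p s → s ≡ 1ℚ → (∀ j → coeffℤ p j ≡ s * coeffℤ p (n ℤ.- j)) → 𝒫 n p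
  symmetric⇒𝒫 n p s s≡1 sym-p j = trans (sym-p j)
    (trans (cong (_* coeffℤ p (n ℤ.- j)) s≡1) (ℚ.*-identityˡ (coeffℤ p (n ℤ.- j))))

  symmetric⇒𝒜 : ∀ n p s → s ≡ - 1ℚ → (∀ j → coeffℤ p j ≡ s * coeffℤ p (n ℤ.- j)) → 𝒜 n p
  symmetric⇒𝒜 n p s s≡-1 sym-p j = trans (sym-p j)
    (trans (cong (_* coeffℤ p (n ℤ.- j)) s≡-1) (neg-one-* (coeffℤ p (n ℤ.- j))))

  coeffℤ-· : ∀ c p j → coeffℤ (c · p) j ≡ c * coeffℤ p j
  coeffℤ-· c p (ℤ.+ j)  = coeff-· c p j
  coeffℤ-· c p -[1+ j ] = sym (ℚ.*-zeroʳ c)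

  ·-𝒫 : ∀ c p n → 𝒫 n p → 𝒫 n (c · p)
  ·-𝒫 c p n p∈𝒫 j = trans (coeffℤ-· c p j) (trans (cong (c *_) (p∈𝒫 j)) (sym (coeffℤ-· c p (n ℤ.- j))))

  ·-𝒜 : ∀ c p n → 𝒜 n p → 𝒜 n (c · p)
  ·-𝒜 c p n p∈𝒜 j = begin
    coeffℤ (c · p) j                  ≡⟨ coeffℤ-· c p j ⟩
    c * coeffℤ p j                    ≡⟨ cong (c *_) (p∈𝒜 j) ⟩
    c * - coeffℤ p (n ℤ.- j)          ≡⟨ ℚ.neg-distribʳ-* c _ ⟨
    - (c * coeffℤ p (n ℤ.- j))        ≡⟨ cong -_ (coeffℤ-· c p (n ℤ.- j)) ⟨
    - coeffℤ (c · p) (n ℤ.- j)        ∎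

-- The parity of md + 2.

module Parity where

  open import Data.Integer.Base using (_+_; _*_)
  import Data.Integer.Divisibility as Unsigned
  open import Data.Integer.Divisibility.Signed as Signed using (∣ᵤ⇒∣; ∣m∣n⇒∣m+n; ∣m+n∣n⇒∣m; ∣n⇒∣m*n)
  import Data.Nat.Divisibility as ∣
  open import Data.Nat.Primality using (euclidsLemma; prime?)
  open import Data.Sum.Base using (_⊎_; inj₁; inj₂)
  open import Relation.Nullary.Decidable using (toWitness)
  open Reflection using (sign)

  -- Each alternative records the parity next to the value, so that a known parity of the exponent
  -- excludes the other one.
  [-1]^-parity : ∀ n → (2 ∣ℕ n × (ℚ.- 1ℚ) ^ n ≡ 1ℚ) ⊎ (¬ 2 ∣ℕ n × (ℚ.- 1ℚ) ^ n ≡ ℚ.- 1ℚ)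
  [-1]^-parity zero          = inj₁ ((2 ∣.∣0) , refl)
  [-1]^-parity (suc zero)    = inj₂ ((λ 2∣1 → contradiction (∣.∣⇒≤ 2∣1) λ { (s≤s ()) }) , refl)
  [-1]^-parity (suc (suc n)) with [-1]^-parity n
  ... | inj₁ (2∣n , eq) = inj₁ (∣.∣m∣n⇒∣m+n ∣.∣-refl 2∣n , cong (λ z → ℚ.- 1ℚ ℚ.* (ℚ.- 1ℚ ℚ.* z)) eq)
  ... | inj₂ (2∤n , eq) = inj₂ ((λ 2∣2+n → 2∤n (∣.∣m+n∣m⇒∣n 2∣2+n ∣.∣-refl)) , cong (λ z → ℚ.- 1ℚ ℚ.* (ℚ.- 1ℚ ℚ.* z)) eq)

  sign-even : ∀ m d → ℤ.+ 2 Unsigned.∣ d → sign (ℤ.+ m * d + ℤ.+ 2) ≡ 1ℚ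
  sign-even m d 2∣d with [-1]^-parity ℤ.∣ ℤ.+ m * d + ℤ.+ 2 ∣
  ... | inj₁ (_ , eq) = eq
  ... | inj₂ (2∤k , _) = contradiction (∣⇒∣ᵤ (∣m∣n⇒∣m+n (∣n⇒∣m*n (ℤ.+ m) (∣ᵤ⇒∣ 2∣d)) (Signed.∣-refl {ℤ.+ 2}))) 2∤k

  sign-odd : ∀ m d → ¬ 2 ∣ℕ m → ¬ ℤ.+ 2 Unsigned.∣ d → sign (ℤ.+ m * d + ℤ.+ 2) ≡ ℚ.- 1ℚ
  sign-odd m d 2∤m 2∤d with [-1]^-parity ℤ.∣ ℤ.+ m * d + ℤ.+ 2 ∣
  ... | inj₂ (_ , eq) = eq
  -- If md + 2 were even, 2 would divide md, and being prime it would divide `m` or `d`.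
  ... | inj₁ (2∣k , _) with euclidsLemma m ℤ.∣ d ∣ (toWitness {a? = prime? 2} _)
                              (subst (2 ∣ℕ_) (ℤ.abs-* (ℤ.+ m) d) (∣⇒∣ᵤ (∣m+n∣n⇒∣m {m = ℤ.+ m * d} (∣ᵤ⇒∣ {ℤ.+ 2} {ℤ.+ m * d + ℤ.+ 2} 2∣k) (Signed.∣-refl {ℤ.+ 2}))))
  ...   | inj₁ 2∣m = contradiction 2∣m 2∤m
  ...   | inj₂ 2∣d = contradiction 2∣d 2∤d

-- Symmetry of `f` over ℤ and vanishing of the numbers `β̃`.

module Conclusion where

  open import Data.Rational.Base using (_*_; -_)
  open Congruence using (f-degree)
  open DegenerateBernoulli using (β-taylor)
  open Reflection using (sign; f-symmetric)
  open Symmetry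

  f-symmetricℤ : ∀ n d → let k = ℤ.+ suc n ℤ.* d ℤ.+ ℤ.+ 2; p = f (suc n) k in
    ∀ j → coeffℤ p j ≡ sign k * coeffℤ p (ℤ.+ suc n ℤ.- ℤ.+ 2 ℤ.- j)
  f-symmetricℤ n d = symmetric-coeffℤ n (f (suc n) k) (sign k) (f-degree (suc n) k) (f-symmetric n d)
    where k = ℤ.+ suc n ℤ.* d ℤ.+ ℤ.+ 2

  β̃-zero : ∀ n d k → ℤ.+ k ≡ ℤ.+ suc n ℤ.* d ℤ.+ ℤ.+ 2 → sign (ℤ.+ k) ≡ - 1ℚ → β̃ k (suc n) ≡ 0ℚ
  -- The index 0 is excluded by `odd`, since its sign is 1; at positive indices `f′` is `f`.
  β̃-zero n d (suc k) k≡ odd = trans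
    (cong (fromℕ (suc n) ^ suc k *_) (β-taylor n (suc k) {{1/n-nonZero (suc n)}}
      (antisymmetric⇒root n (f (suc n) (ℤ.+ suc k)) (sign (ℤ.+ suc k)) odd (f-degree (suc n) (ℤ.+ suc k)) symmetric)))
    (ℚ.*-zeroʳ (fromℕ (suc n) ^ suc k))
    where
    symmetric : ∀ i → i ℕ.< n →
      coeff (f (suc n) (ℤ.+ suc k)) i ≡ sign (ℤ.+ suc k) * coeff (f (suc n) (ℤ.+ suc k)) (n ℕ.∸ suc i)
    symmetric i i<n = subst (λ k → coeff (f (suc n) k) i ≡ sign k * coeff (f (suc n) k) (n ℕ.∸ suc i))
      (sym k≡) (f-symmetric n d i i<n)

open Conclusion
open Parity using (sign-even; sign-odd)
open Reflection using (sign)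
open Symmetry using (symmetric⇒𝒫; symmetric⇒𝒜; ·-𝒫; ·-𝒜)
open import Data.Integer using (+_; _+_; _-_; _*_)
open import Data.Integer.Divisibility using (_∣_)
open import Data.Nat using (NonZero)
open import Relation.Unary using (_∈_)

theorem6p2 :
  ∀ (m : ℕ) .{{_ : NonZero m}} → ¬ (2 ∣ℕ m) → (d : ℤ) →
    ((+ 2 ∣ d → f m (+ m * d + + 2) ∈ 𝒫 (+ m - + 2)) ×
     (¬ (+ 2 ∣ d) → f m (+ m * d + + 2) ∈ 𝒜 (+ m - + 2))) ×
    (∀ (k : ℕ) → + k ≡ + m * d + + 2 →
      (+ 2 ∣ d → β̃ₚ k m ∈ 𝒫 (+ m - + 2)) ×
      (¬ (+ 2 ∣ d) → β̃ₚ k m ∈ 𝒜 (+ m - + 2)) ×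
      (¬ (+ 2 ∣ d) → β̃ k m ≡ 0ℚ))
theorem6p2 m@(suc n) 2∤m d = (palindromic , antipalindromic) , λ k k≡ →
    -- `β̃ₚ k m` is by definition `scale k` times `f m (+ k)`, and both symmetry classes are closed
    -- under scalar multiplication.
    (λ 2∣d → ·-𝒫 (scale k) (f m (+ k)) darga (subst (λ k → 𝒫 darga (f m k)) (sym k≡) (palindromic 2∣d)))
  , (λ 2∤d → ·-𝒜 (scale k) (f m (+ k)) darga (subst (λ k → 𝒜 darga (f m k)) (sym k≡) (antipalindromic 2∤d)))
  , (λ 2∤d → β̃-zero n d k k≡ (trans (cong sign k≡) (sign-odd m d 2∤m 2∤d)))
  where
  K darga : ℤ
  K     = + m * d + + 2
  darga = + m - + 2
  scale : ℕ → ℚ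
  scale k = (ℚ.- 1ℚ) ^ k ℚ.* fromℕ (k !)
  palindromic : + 2 ∣ d → 𝒫 darga (f m (+ m * d + + 2))
  palindromic 2∣d = symmetric⇒𝒫 darga (f m K) (sign K) (sign-even m d 2∣d) (f-symmetricℤ n d)
  antipalindromic : ¬ (+ 2 ∣ d) → 𝒜 darga (f m (+ m * d + + 2))
  antipalindromic 2∤d = symmetric⇒𝒜 darga (f m K) (sign K) (sign-odd m d 2∤m 2∤d) (f-symmetricℤ n d)
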